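{- Let $(W,S)$ be a Coxeter system with $S$ finite (not necessarily finite or irreducible $W$). For any $v\in W$, the set of elements $w\ge v$ in the right weak order such that $[v,w]$ is a Boolean interval (including $w=v$) is in bijection with the collection of independent sets (including the empty set) of the induced subgraph $\Gamma_W[S\setminus\mathrm{Des}(v)]$ of the Coxeter graph obtained by deleting the elements of $\mathrm{Des}(v)$ from its vertex set.
   Context: The Coxeter matrix $m$ of $(W,S)$ has $m(s,s')$ the order of $ss'$. The Coxeter graph $\Gamma_W$ has vertex set $S$ and an edge between $s,s'$ iff $m(s,s')\ge 3$ (so two generators commute iff they are non-adjacent). The right weak order on $W$: $u\le w$ iff $\ell(w)=\ell(u)+\ell(u^{ -1}w)$, where $\ell$ is Coxeter length. $\mathrm{Des}(v)=\{s\in S:\ell(vs)=\ell(v)-1\}$. An interval is Boolean if it is isomorphic to the lattice of subsets of a finite set. An independent set of a graph is a set of vertices no two of which are adjacent. -}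

module Defs where

open import Data.Nat using (ℕ; zero; suc; _+_; _≤_)
open import Data.Fin using (Fin)
open import Data.Fin.Subset using (Subset; _∈_; _⊆_)
open import Data.List using (List; []; _∷_; _++_; length; reverse; [_])
open import Data.Product using (Σ; _×_; _,_; proj₁)
open import Data.Unit using (⊤)
open import Relation.Nullary using (¬_)
open import Relation.Binary.PropositionalEquality using (_≡_; _≢_; refl; sym; trans)
open import Relation.Binary.Bundles using (Setoid)
open import Relation.Binary.Structures using (IsEquivalence)
open import Function.Bundles using (_⇔_)

data ℕ∞ : Set where
  fin : ℕ → ℕ∞
  ∞   : ℕ∞

record CoxeterMatrix (n : ℕ) : Set where
  field
    m     : Fin n → Fin n → ℕ∞
    diag  : ∀ s → m s s ≡ fin 1
    symm  : ∀ s t → m s t ≡ m t s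
    off   : ∀ s t → s ≢ t → ∀ k → m s t ≡ fin k → 2 ≤ k
open CoxeterMatrix public

module Coxeter {n : ℕ} (M : CoxeterMatrix n) where

  Word : Set
  Word = List (Fin n)

  pow : Fin n → Fin n → ℕ → Word
  pow s t zero    = []
  pow s t (suc k) = s ∷ t ∷ pow s t k

  -- Equality in W = ⟨ S | (s t)^{m(s,t)} = 1 for m(s,t) < ∞ ⟩ :
  -- the congruence on words generated by the defining relations.
  data _~_ : Word → Word → Set where
    rel    : ∀ {s t k} (u w : Word) → m M s t ≡ fin k →
             (u ++ pow s t k ++ w) ~ (u ++ w)
    ~refl  : ∀ {x} → x ~ x
    ~sym   : ∀ {x y} → x ~ y → y ~ x
    ~trans : ∀ {x y z} → x ~ y → y ~ z → x ~ z

  infix 4 _~_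

  IsLen : Word → ℕ → Set
  IsLen x k = Σ Word (λ y → y ~ x × length y ≡ k)
            × (∀ y → y ~ x → k ≤ length y)

  -- inverse of an element (s⁻¹ = s)
  inv : Word → Word
  inv = reverse

  _≤W_ : Word → Word → Set
  u ≤W w = Σ ℕ λ a → Σ ℕ λ b → IsLen u a × IsLen (inv u ++ w) b × IsLen w (a + b)

  Des : Word → Fin n → Set
  Des v s = Σ ℕ λ k → IsLen (v ++ [ s ]) k × IsLen v (suc k)

  BooleanInterval : Word → Word → Set
  BooleanInterval v w =
    Σ ℕ λ k → Σ (Subset k → Word) λ f →
        (∀ A → v ≤W f A × f A ≤W w)
      × (∀ A B → f A ~ f B → A ≡ B)
      × (∀ x → v ≤W x → x ≤W w → Σ (Subset k) λ A → x ~ f A)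
      × (∀ A B → (A ⊆ B) ⇔ (f A ≤W f B))

  Adjacent : Fin n → Fin n → Set
  Adjacent s t with m M s t
  ... | fin k = 3 ≤ k
  ... | ∞     = ⊤

  Independent : Word → Subset n → Set
  Independent v I = (∀ s → s ∈ I → ¬ Des v s)
                  × (∀ s t → s ∈ I → t ∈ I → ¬ Adjacent s t)

  IndepSetoid : Word → Setoid _ _
  IndepSetoid v = record
    { Carrier = Σ (Subset n) (Independent v)
    ; _≈_ = λ I J → proj₁ I ≡ proj₁ J
    ; isEquivalence = record { refl = refl ; sym = sym ; trans = trans } }

  BoolUpSetoid : Word → Setoid _ _
  BoolUpSetoid v = record
    { Carrier = Σ Word (λ w → v ≤W w × BooleanInterval v w)
    ; _≈_ = λ x y → proj₁ x ~ proj₁ y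
    ; isEquivalence = record { refl = ~refl ; sym = ~sym ; trans = ~trans } }

{-# OPTIONS --safe #-}

-- Let I(w) be the set of those s ∉ Des(v) with v s ≤ w. If [v , w] is Boolean, its atoms are
-- the v s with s ∈ I(w), and w is their join. Two elements s, t of I(w) commute: the join of
-- v s and v t is v x, where x starts with the alternating words in s and t of length m(s,t),
-- and for m(s,t) ≥ 3 the interval below it contains v s t besides v, v s, v t and v x.
-- So I(w) is independent and w = v ∏ I(w). Conversely, for every independent I ⊆ S ∖ Des(v),
-- the interval [v , v ∏ I] = { v ∏ A : A ⊆ I } is Boolean.
--
-- Lengths have to be computed, so the word problem is solved on the way: s is a left descent
-- of a reduced word starting with t ≠ s iff that word can be rewritten to start with the
-- alternating words in s and t of length m(s,t). This rests on the exchange condition, proved by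
-- counting reflections modulo 2, and on the order of s t being exactly m(s,t). For the latter,
-- the geometric representation is formed over ℤ, the coefficient 2cos(π/m) being replaced
-- by the adjacency operator of a union of paths with m − 1 vertices, whose eigenvalues are
-- 2cos(kπ/m) for 0 < k < m.

module Submission where

open import Defs
open import Algebra.Bundles using (Group)
import Algebra.Properties.Group as GroupProperties
open import Data.Bool using (Bool; true; false; not; _xor_; if_then_else_)
import Data.Bool.Properties as Bool
open import Data.Empty using (⊥; ⊥-elim)
open import Data.Fin using (Fin)
import Data.Fin.Properties as Fin
open import Data.Fin.Subset using (Subset; _⊆_; _∪_; _∩_; ⁅_⁆) renaming (_∈_ to _∈ˢ_)
import Data.Fin.Subset as Subset
import Data.Fin.Subset.Properties as Subset
open import Data.Integer using (ℤ; 0ℤ; 1ℤ; -_) renaming (_+_ to _⊕_; _-_ to _⊖_)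
import Data.Integer.Properties as ℤ
open import Data.Integer.Tactic.RingSolver using (solve-∀)
open import Data.List using (List; []; _∷_; _++_; length; [_]; lookup; filter; allFin; applyUpTo)
open import Data.List.Membership.Propositional using (_∈_)
open import Data.List.Membership.Propositional.Properties using (∈-filter⁺; ∈-filter⁻; ∈-allFin; ∈-lookup)
import Data.List.Properties as List
open import Data.List.Relation.Binary.Pointwise using (Pointwise; []; _∷_)
open import Data.List.Relation.Unary.All as All using (All; []; _∷_)
open import Data.List.Relation.Unary.AllPairs using (AllPairs; []; _∷_)
open import Data.List.Relation.Unary.Any using (Any; here; there)
open import Data.List.Relation.Unary.Unique.Propositional using (Unique)
import Data.List.Relation.Unary.Unique.Propositional.Properties as Unique
open import Data.Nat using (ℕ; zero; suc; pred; _+_; _*_; _≤_; _<_; z≤n; s≤s; _≤?_)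
open import Data.Nat.Divisibility using (_∣_; _∣?_; _∣0; ∣m+n∣m⇒∣n; >⇒∤; n∣m*n; ∣m∣n⇒∣m+n; ∣-refl; 0∣⇒≡0)
open import Data.Nat.DivMod using (_/_; _%_; m≡m%n+[m/n]*n; m%n<n)
import Data.Nat.Properties as ℕ
open import Data.Product using (Σ; ∃; _×_; _,_; proj₁; proj₂)
open import Data.Sum using (_⊎_; inj₁; inj₂)
open import Data.Vec using ([]; _∷_; here; there; tabulate)
import Data.Vec.Properties as Vec
open import Function using (id; _∘_; _⇔_; mk⇔)
open import Function.Bundles using (Bijection; module Equivalence)
open import Level using (0ℓ)
open import Relation.Binary.PropositionalEquality
  using (_≡_; _≢_; refl; sym; trans; cong; cong₂; subst; subst₂; ≢-sym; module ≡-Reasoning)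
import Relation.Binary.Reasoning.Setoid as SetoidReasoning
open import Relation.Nullary using (¬_; Dec; yes; no; does; contradiction)
open import Relation.Nullary.Decidable
  using (decidable-stable; map′; _×-dec_; dec-true; dec-false; ¬¬-excluded-middle)

-- The path operator and its Chebyshev polynomials

module PathOperator where
  open ≡-Reasoning

  infix 4 _≐_
  _≐_ : (ℕ → ℤ) → (ℕ → ℤ) → Set
  f ≐ g = ∀ j → f j ≡ g j

  -- The edge joining j - 1 to j, removed when d divides j. As every d divides 0, the fictitious
  -- neighbour `pred 0` never contributes; as 0 divides only 0, the choice d = 0 leaves one infinite
  -- path.
  gate : ℕ → ℕ → ℤ → ℤ
  gate d j a = if does (d ∣? j) then 0ℤ else a

  gate-closed : ∀ {d j} a → d ∣ j → gate d j a ≡ 0ℤ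
  gate-closed {d} {j} a p = cong (if_then 0ℤ else a) (dec-true (d ∣? j) p)

  gate-open : ∀ {d j} a → ¬ d ∣ j → gate d j a ≡ a
  gate-open {d} {j} a p = cong (if_then 0ℤ else a) (dec-false (d ∣? j) p)

  gate-+ : ∀ d j a b → gate d j (a ⊕ b) ≡ gate d j a ⊕ gate d j b
  gate-+ d j a b with does (d ∣? j)
  ... | true  = refl
  ... | false = refl

  gate-neg : ∀ d j a → gate d j (- a) ≡ - gate d j a
  gate-neg d j a with does (d ∣? j)
  ... | true  = refl
  ... | false = refl

  -- The adjacency operator of the path on ℕ cut in front of every multiple of d.
  -- For d = m − 1 ≥ 1 all pieces have m − 1 vertices, and the adjacency matrix of
  -- such a piece has the eigenvalues 2cos(kπ/m): it plays the role of 2cos(π/m).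
  path : ℕ → (ℕ → ℤ) → ℕ → ℤ
  path d f j = gate d j (f (pred j)) ⊕ gate d (suc j) (f (suc j))

  path-cong : ∀ d {f g} → f ≐ g → path d f ≐ path d g
  path-cong d e j = cong₂ (λ a b → gate d j a ⊕ gate d (suc j) b) (e (pred j)) (e (suc j))

  path-+ : ∀ d f g → path d (λ i → f i ⊕ g i) ≐ λ i → path d f i ⊕ path d g i
  path-+ d f g j = trans
    (cong₂ _⊕_ (gate-+ d j (f (pred j)) (g (pred j))) (gate-+ d (suc j) (f (suc j)) (g (suc j))))
    (swap (gate d j (f (pred j))) (gate d j (g (pred j)))
          (gate d (suc j) (f (suc j))) (gate d (suc j) (g (suc j))))
    where
    swap : ∀ a b c e → (a ⊕ b) ⊕ (c ⊕ e) ≡ (a ⊕ c) ⊕ (b ⊕ e)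
    swap = solve-∀

  path-neg : ∀ d f → path d (λ i → - f i) ≐ λ i → - path d f i
  path-neg d f j = trans
    (cong₂ _⊕_ (gate-neg d j (f (pred j))) (gate-neg d (suc j) (f (suc j))))
    (sym (ℤ.neg-distrib-+ (gate d j (f (pred j))) (gate d (suc j) (f (suc j)))))

  path-minus : ∀ d f g → path d (λ i → f i ⊖ g i) ≐ λ i → path d f i ⊖ path d g i
  path-minus d f g j = trans (path-+ d f (λ i → - g i) j) (cong (path d f j ⊕_) (path-neg d g j))

  path-0 : ∀ d → path d (λ _ → 0ℤ) ≐ λ _ → 0ℤ
  path-0 d j with does (d ∣? j) | does (d ∣? suc j)
  ... | true  | true  = refl
  ... | true  | false = refl
  ... | false | true  = refl
  ... | false | false = refl

  -- With the usual indexing, cheb d k is the Chebyshev polynomial U_{k−1}(X/2) at the path operator X.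
  cheb : ℕ → ℕ → (ℕ → ℤ) → ℕ → ℤ
  cheb d 0             f = λ _ → 0ℤ
  cheb d 1             f = f
  cheb d (suc (suc k)) f = λ j → cheb d (suc k) (path d f) j ⊖ cheb d k f j

  cheb-cong : ∀ d k {f g} → f ≐ g → cheb d k f ≐ cheb d k g
  cheb-cong d 0             e j = refl
  cheb-cong d 1             e j = e j
  cheb-cong d (suc (suc k)) e j =
    cong₂ _⊖_ (cheb-cong d (suc k) (path-cong d e) j) (cheb-cong d k e j)

  cheb-+ : ∀ d k f g → cheb d k (λ i → f i ⊕ g i) ≐ λ i → cheb d k f i ⊕ cheb d k g i
  cheb-+ d 0 f g j = refl
  cheb-+ d 1 f g j = refl
  cheb-+ d (suc (suc k)) f g j = trans
    (cong₂ _⊖_ (trans (cheb-cong d (suc k) (path-+ d f g) j)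
                      (cheb-+ d (suc k) (path d f) (path d g) j))
               (cheb-+ d k f g j))
    (swap (cheb d (suc k) (path d f) j) (cheb d (suc k) (path d g) j) (cheb d k f j) (cheb d k g j))
    where
    swap : ∀ a b c e → (a ⊕ b) ⊖ (c ⊕ e) ≡ (a ⊖ c) ⊕ (b ⊖ e)
    swap = solve-∀

  cheb-neg : ∀ d k f → cheb d k (λ i → - f i) ≐ λ i → - cheb d k f i
  cheb-neg d 0 f j = refl
  cheb-neg d 1 f j = refl
  cheb-neg d (suc (suc k)) f j = trans
    (cong₂ _⊖_ (trans (cheb-cong d (suc k) (path-neg d f) j) (cheb-neg d (suc k) (path d f) j))
               (cheb-neg d k f j))
    (swap (cheb d (suc k) (path d f) j) (cheb d k f j))
    where
    swap : ∀ a b → - a ⊖ - b ≡ - (a ⊖ b)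
    swap = solve-∀

  cheb-minus : ∀ d k f g → cheb d k (λ i → f i ⊖ g i) ≐ λ i → cheb d k f i ⊖ cheb d k g i
  cheb-minus d k f g j = trans (cheb-+ d k f (λ i → - g i) j) (cong (cheb d k f j ⊕_) (cheb-neg d k g j))

  cheb-0 : ∀ d k → cheb d k (λ _ → 0ℤ) ≐ λ _ → 0ℤ
  cheb-0 d 0 j = refl
  cheb-0 d 1 j = refl
  cheb-0 d (suc (suc k)) j = cong₂ _⊖_
    (trans (cheb-cong d (suc k) (path-0 d) j) (cheb-0 d (suc k) j)) (cheb-0 d k j)

  cheb-path : ∀ d k f → cheb d k (path d f) ≐ path d (cheb d k f)
  cheb-path d 0 f j = sym (path-0 d j)
  cheb-path d 1 f j = refl
  cheb-path d (suc (suc k)) f j = trans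
    (cong₂ _⊖_ (cheb-path d (suc k) (path d f) j) (cheb-path d k f j))
    (sym (path-minus d (cheb d (suc k) (path d f)) (cheb d k f) j))

  -- Polynomials in one operator commute; `cheb-vanish` uses this to exchange an evaluating
  -- polynomial with the vanishing one.
  cheb-comm : ∀ d k l f → cheb d k (cheb d l f) ≐ cheb d l (cheb d k f)
  cheb-comm d 0 l f j = sym (cheb-0 d l j)
  cheb-comm d 1 l f j = refl
  cheb-comm d (suc (suc k)) l f j = begin
    cheb d (suc k) (path d (cheb d l f)) j ⊖ cheb d k (cheb d l f) j
      ≡⟨ cong (_⊖ cheb d k (cheb d l f) j) (cheb-cong d (suc k) (λ i → sym (cheb-path d l f i)) j) ⟩
    cheb d (suc k) (cheb d l (path d f)) j ⊖ cheb d k (cheb d l f) j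
      ≡⟨ cong₂ _⊖_ (cheb-comm d (suc k) l (path d f) j) (cheb-comm d k l f j) ⟩
    cheb d l (cheb d (suc k) (path d f)) j ⊖ cheb d l (cheb d k f) j
      ≡⟨ sym (cheb-minus d l (cheb d (suc k) (path d f)) (cheb d k f) j) ⟩
    cheb d l (cheb d (suc (suc k)) f) j ∎

  cheb-step : ∀ d k f → cheb d (suc (suc k)) f ≐ λ j → path d (cheb d (suc k) f) j ⊖ cheb d k f j
  cheb-step d k f j = cong (_⊖ cheb d k f j) (cheb-path d (suc k) f j)

  -- Polynomials in the path operator, evaluated at the left end of a piece, reach every point of it.
  cheb-end : ∀ d b r f → d ∣ b → (∀ i → i < r → ¬ d ∣ suc (i + b)) →
             cheb d (suc (suc r)) f b ≡ gate d (suc (r + b)) (f (suc (r + b)))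
  cheb-end d b 0 f d∣b _ = begin
    gate d b (f (pred b)) ⊕ gate d (suc b) (f (suc b)) ⊖ 0ℤ
      ≡⟨ cong (λ a → a ⊕ gate d (suc b) (f (suc b)) ⊖ 0ℤ) (gate-closed (f (pred b)) d∣b) ⟩
    0ℤ ⊕ gate d (suc b) (f (suc b)) ⊖ 0ℤ
      ≡⟨ drop (gate d (suc b) (f (suc b))) ⟩
    gate d (suc b) (f (suc b)) ∎
    where
    drop : ∀ a → 0ℤ ⊕ a ⊖ 0ℤ ≡ a
    drop = solve-∀
  cheb-end d b (suc r) f d∣b free = begin
    cheb d (suc (suc r)) (path d f) b ⊖ cheb d (suc r) f b
      -- At `suc (r + b)`, `path d f` is the sum over the two neighbours. The lower polynomial gives
      -- the value at the left one, so only the right one survives.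
      ≡⟨ cong₂ _⊖_ (trans (cheb-end d b r (path d f) d∣b (λ i i<r → free i (ℕ.m<n⇒m<1+n i<r)))
                          (gate-open _ (free r ℕ.≤-refl)))
                   (below r (λ i i<r → free i (ℕ.m<n⇒m<1+n i<r))) ⟩
    gate d (suc (r + b)) (f (r + b)) ⊕ gate d (suc (suc r + b)) (f (suc (suc r + b))) ⊖ f (r + b)
      ≡⟨ cong (λ a → a ⊕ gate d (suc (suc r + b)) (f (suc (suc r + b))) ⊖ f (r + b))
              (gate-open _ (free r ℕ.≤-refl)) ⟩
    f (r + b) ⊕ gate d (suc (suc r + b)) (f (suc (suc r + b))) ⊖ f (r + b)
      ≡⟨ drop (f (r + b)) (gate d (suc (suc r + b)) (f (suc (suc r + b)))) ⟩
    gate d (suc (suc r + b)) (f (suc (suc r + b))) ∎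
    where
    drop : ∀ a c → a ⊕ c ⊖ a ≡ c
    drop = solve-∀
    below : ∀ r → (∀ i → i < r → ¬ d ∣ suc (i + b)) → cheb d (suc r) f b ≡ f (r + b)
    below 0       _    = refl
    below (suc r) free = trans (cheb-end d b r f d∣b (λ i i<r → free i (ℕ.m<n⇒m<1+n i<r)))
                               (gate-open _ (free r ℕ.≤-refl))

  cheb-eval : ∀ d b r f → d ∣ b → (∀ i → i < r → ¬ d ∣ suc (i + b)) → cheb d (suc r) f b ≡ f (r + b)
  cheb-eval d b 0       f _   _    = refl
  cheb-eval d b (suc r) f d∣b free =
    trans (cheb-end d b r f d∣b (λ i i<r → free i (ℕ.m<n⇒m<1+n i<r))) (gate-open _ (free r ℕ.≤-refl))

  inside-piece : ∀ d b i → d ∣ b → suc i < d → ¬ d ∣ suc (i + b)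
  inside-piece d b i d∣b i<d d∣ =
    >⇒∤ i<d (∣m+n∣m⇒∣n (subst (d ∣_) (trans (cong suc (ℕ.+-comm i b)) (sym (ℕ.+-suc b i))) d∣) d∣b)

  -- An instance of Cayley-Hamilton: with m = `suc (suc d)`, this is the characteristic polynomial
  -- of a path with m - 1 vertices. The value at j is that of another polynomial at the left end b
  -- of its piece; once the two polynomials are exchanged, this one reads the closed edge at the far
  -- end.
  cheb-vanish : ∀ d f → cheb (suc d) (suc (suc d)) f ≐ λ _ → 0ℤ
  cheb-vanish d f j = begin
    g j                              ≡⟨ cong g (m≡m%n+[m/n]*n j (suc d)) ⟩
    g (r + b)                        ≡⟨ sym (cheb-eval (suc d) b r g D∣b freer) ⟩
    cheb (suc d) (suc r) g b         ≡⟨ cheb-comm (suc d) (suc r) (suc (suc d)) f b ⟩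
    cheb (suc d) (suc (suc d)) (cheb (suc d) (suc r) f) b
      ≡⟨ cheb-end (suc d) b d (cheb (suc d) (suc r) f) D∣b freed ⟩
    gate (suc d) (suc d + b) _       ≡⟨ gate-closed _ (∣m∣n⇒∣m+n ∣-refl D∣b) ⟩
    0ℤ ∎
    where
    g = cheb (suc d) (suc (suc d)) f
    r = j % suc d
    b = j / suc d * suc d
    D∣b : suc d ∣ b
    D∣b = n∣m*n (j / suc d)
    freer : ∀ i → i < r → ¬ suc d ∣ suc (i + b)
    freer i i<r = inside-piece (suc d) b i D∣b (ℕ.≤-<-trans i<r (m%n<n j (suc d)))
    freed : ∀ i → i < d → ¬ suc d ∣ suc (i + b)
    freed i i<d = inside-piece (suc d) b i D∣b (s≤s i<d)

  -- Along (st)ᵏ, the coordinates other than s and t change by sums zₐ + zₐ₊₂ + ⋯ over a wave z,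
  -- and k such terms telescope to cheb d k zₐ₊ₖ₋₁, which vanishes for k = m.
  stepSum : (ℕ → ℕ → ℤ) → ℕ → ℕ → ℕ → ℤ
  stepSum z a zero    j = 0ℤ
  stepSum z a (suc k) j = stepSum z a k j ⊕ z (k * 2 + a) j

  -- The recurrence of the sequence sin(iπ/m), with the path operator in place of 2cos(π/m).
  Wave : ℕ → (ℕ → ℕ → ℤ) → Set
  Wave d z = ∀ i → z (suc (suc i)) ≐ λ j → path d (z (suc i)) j ⊖ z i j

  wave : ℕ → (ℕ → ℤ) → (ℕ → ℤ) → ℕ → ℕ → ℤ
  wave d x y 0             = x
  wave d x y 1             = y
  wave d x y (suc (suc i)) = λ j → path d (wave d x y (suc i)) j ⊖ wave d x y i j

  module _ {d : ℕ} {z : ℕ → ℕ → ℤ} (w : Wave d z) where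

    path-wave : ∀ i → path d (z (suc i)) ≐ λ j → z i j ⊕ z (suc (suc i)) j
    path-wave i j = trans (split (path d (z (suc i)) j) (z i j)) (cong (z i j ⊕_) (sym (w i j)))
      where
      split : ∀ a b → a ≡ b ⊕ (a ⊖ b)
      split = solve-∀

    -- The middle term of the sum is `z (k + a)`, and `path-wave` splits a term into its neighbours.
    -- In the induction step two shifted sums overlap in exactly the sum that is subtracted, so the
    -- first one gains a single term.
    stepSum-cheb : ∀ k a → cheb d (suc k) (z (k + a)) ≐ stepSum z a (suc k)
    stepSum-cheb 0 a j = sym (ℤ.+-identityˡ (z a j))
    stepSum-cheb 1 a j = trans (cong (_⊖ 0ℤ) (path-wave a j)) (pad (z a j) (z (2 + a) j))
      where
      pad : ∀ p q → (p ⊕ q) ⊖ 0ℤ ≡ (0ℤ ⊕ p) ⊕ q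
      pad = solve-∀
    stepSum-cheb (suc (suc k)) a j = begin
      cheb d (2 + k) (path d (z (2 + k + a))) j ⊖ cheb d (suc k) (z (2 + k + a)) j
        ≡⟨ cong (_⊖ cheb d (suc k) (z (2 + k + a)) j)
             (trans (cheb-cong d (2 + k) (path-wave (suc k + a)) j)
                    (cheb-+ d (2 + k) (z (suc k + a)) (z (3 + k + a)) j)) ⟩
      (cheb d (2 + k) (z (suc k + a)) j ⊕ cheb d (2 + k) (z (3 + k + a)) j)
        ⊖ cheb d (suc k) (z (2 + k + a)) j
        ≡⟨ cong₂ (λ p q → (cheb d (2 + k) (z (suc k + a)) j ⊕ cheb d (2 + k) (z p) j) ⊖ cheb d (suc k) (z q) j)
             (shift3 k a) (shift2 k a) ⟩
      (cheb d (2 + k) (z (suc k + a)) j ⊕ cheb d (2 + k) (z (suc k + (2 + a))) j)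
        ⊖ cheb d (suc k) (z (k + (2 + a))) j
        ≡⟨ cong₂ _⊖_ (cong₂ _⊕_ (stepSum-cheb (suc k) a j) (stepSum-cheb (suc k) (2 + a) j))
                     (stepSum-cheb k (2 + a) j) ⟩
      (stepSum z a (2 + k) j ⊕ (stepSum z (2 + a) (suc k) j ⊕ z (suc k * 2 + (2 + a)) j))
        ⊖ stepSum z (2 + a) (suc k) j
        ≡⟨ drop (stepSum z a (2 + k) j) (stepSum z (2 + a) (suc k) j) (z (suc k * 2 + (2 + a)) j) ⟩
      stepSum z a (2 + k) j ⊕ z (suc k * 2 + (2 + a)) j
        ≡⟨ cong (λ i → stepSum z a (2 + k) j ⊕ z i j) (shiftS (suc k) a) ⟩
      stepSum z a (3 + k) j ∎
      where
      drop : ∀ p q r → (p ⊕ (q ⊕ r)) ⊖ q ≡ p ⊕ r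
      drop = solve-∀
      shift2 : ∀ k a → 2 + k + a ≡ k + (2 + a)
      shift2 k a = sym (trans (ℕ.+-suc k (suc a)) (cong suc (ℕ.+-suc k a)))
      shift3 : ∀ k a → 3 + k + a ≡ suc k + (2 + a)
      shift3 k a = cong suc (shift2 k a)
      shiftS : ∀ k a → k * 2 + (2 + a) ≡ suc k * 2 + a
      shiftS k a = sym (shift2 (k * 2) a)

  stepSum-first : ∀ z a k j → stepSum z a (suc k) j ≡ z a j ⊕ stepSum z (2 + a) k j
  stepSum-first z a zero    j = ℤ.+-comm 0ℤ (z a j)
  stepSum-first z a (suc k) j = begin
    stepSum z a (suc k) j ⊕ z (suc k * 2 + a) j
      ≡⟨ cong₂ _⊕_ (stepSum-first z a k j) (cong (λ i → z i j)
           (sym (trans (ℕ.+-suc (k * 2) (suc a)) (cong suc (ℕ.+-suc (k * 2) a))))) ⟩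
    z a j ⊕ stepSum z (2 + a) k j ⊕ z (k * 2 + (2 + a)) j
      ≡⟨ ℤ.+-assoc (z a j) _ _ ⟩
    z a j ⊕ stepSum z (2 + a) (suc k) j ∎

  wave-sum : ∀ d z → Wave (suc d) z → ∀ a → stepSum z a (2 + d) ≐ λ _ → 0ℤ
  wave-sum d z w a j = trans (sym (stepSum-cheb w (suc d) a j)) (cheb-vanish d (z (suc d + a)) j)

  -- With m = `2 + d`, the sums of m alternate terms from a and from 2 + a both vanish; they differ
  -- by z (2m + a) - z a.
  wave-period : ∀ d z → Wave (suc d) z → ∀ a → z ((2 + d) * 2 + a) ≐ z a
  wave-period d z w a j = begin
    z ((2 + d) * 2 + a) j
      ≡⟨ sym (ℤ.+-identityˡ _) ⟩
    0ℤ ⊕ z ((2 + d) * 2 + a) j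
      ≡⟨ cong (_⊕ z ((2 + d) * 2 + a) j) (sym (wave-sum d z w a j)) ⟩
    stepSum z a (3 + d) j
      ≡⟨ stepSum-first z a (2 + d) j ⟩
    z a j ⊕ stepSum z (2 + a) (2 + d) j
      ≡⟨ cong (z a j ⊕_) (wave-sum d z w (2 + a) j) ⟩
    z a j ⊕ 0ℤ
      ≡⟨ ℤ.+-identityʳ _ ⟩
    z a j ∎

open PathOperator

-- A representation in which no dihedral relation is lost

module Representation {n : ℕ} (M : CoxeterMatrix n) where
  open Coxeter M
  open ≡-Reasoning

  -- A finite label m gives pieces with m - 1 vertices (for m = 2 every edge is cut and the operator
  -- is 0); the label ∞ gives the infinite path, on which no `cheb` of positive index vanishes.
  cut : ℕ∞ → ℕ
  cut (fin k) = pred k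
  cut ∞       = 0

  -- Each coordinate is a function on ℕ rather than a number, so that path operators can act on it
  -- in place of the scalars 2cos(π/m).
  V : Set
  V = Fin n → ℕ → ℤ

  infix 4 _≋_
  _≋_ : V → V → Set
  f ≋ g = ∀ r → f r ≐ g r

  bond : Fin n → Fin n → ℕ
  bond s r = cut (m M s r)

  link : Fin n → Fin n → (ℕ → ℤ) → ℕ → ℤ
  link s r = path (bond s r)

  -- The dual of the geometric representation: `f r` stands for the value of a functional at the
  -- simple root r, and s maps that root to itself plus 2cos(π/m(s,r)) times the root s.
  refl-act : Fin n → V → V
  refl-act s f r with s Fin.≟ r
  ... | yes _ = λ j → - f s j
  ... | no  _ = λ j → f r j ⊕ link s r (f s) j

  refl-act-same : ∀ s f → refl-act s f s ≐ λ j → - f s j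
  refl-act-same s f j with s Fin.≟ s
  ... | yes _   = refl
  ... | no  s≢s = contradiction refl s≢s

  refl-act-other : ∀ s r f → s ≢ r → refl-act s f r ≐ λ j → f r j ⊕ link s r (f s) j
  refl-act-other s r f s≢r j with s Fin.≟ r
  ... | yes s≡r = contradiction s≡r s≢r
  ... | no  _   = refl

  refl-act-cong : ∀ s {f g} → f ≋ g → refl-act s f ≋ refl-act s g
  refl-act-cong s e r j with s Fin.≟ r
  ... | yes _ = cong -_ (e s j)
  ... | no  _ = cong₂ _⊕_ (e r j) (path-cong (bond s r) (e s) j)

  act : Word → V → V
  act []      f = f
  act (s ∷ x) f = refl-act s (act x f)

  act-cong : ∀ x {f g} → f ≋ g → act x f ≋ act x g
  act-cong []      e = e
  act-cong (s ∷ x) e = refl-act-cong s (act-cong x e)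

  act-++ : ∀ x y f → act (x ++ y) f ≡ act x (act y f)
  act-++ []      y f = refl
  act-++ (s ∷ x) y f = cong (refl-act s) (act-++ x y f)

  refl-act-invol : ∀ s f → refl-act s (refl-act s f) ≋ f
  refl-act-invol s f r j with s Fin.≟ r
  ... | yes refl = trans (cong -_ (refl-act-same s f j)) (ℤ.neg-involutive (f s j))
  ... | no  s≢r  = begin
    refl-act s f r j ⊕ link s r (refl-act s f s) j
      ≡⟨ cong₂ _⊕_ (refl-act-other s r f s≢r j)
           (trans (path-cong (bond s r) (refl-act-same s f) j) (path-neg (bond s r) (f s) j)) ⟩
    (f r j ⊕ link s r (f s) j) ⊖ link s r (f s) j
      ≡⟨ drop (f r j) (link s r (f s) j) ⟩
    f r j ∎
    where
    drop : ∀ a b → (a ⊕ b) ⊖ b ≡ a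
    drop = solve-∀

  -- Alternating reflections shift the pair (−zᵢ , zᵢ₊₁) of consecutive values of a wave.
  refl-act-wave : ∀ {s t} → s ≢ t → ∀ {z} → Wave (bond s t) z → ∀ i f →
    f t ≐ (λ j → - z i j) → f s ≐ z (suc i) →
    refl-act s f s ≐ (λ j → - z (suc i) j) × refl-act s f t ≐ z (suc (suc i))
  refl-act-wave {s} {t} s≢t {z} w i f ft fs =
    (λ j → trans (refl-act-same s f j) (cong -_ (fs j))) ,
    (λ j → begin
      refl-act s f t j                            ≡⟨ refl-act-other s t f s≢t j ⟩
      f t j ⊕ link s t (f s) j                    ≡⟨ cong₂ _⊕_ (ft j) (path-cong (bond s t) fs j) ⟩
      - z i j ⊕ link s t (z (suc i)) j            ≡⟨ ℤ.+-comm (- z i j) _ ⟩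
      link s t (z (suc i)) j ⊖ z i j              ≡⟨ sym (w i j) ⟩
      z (suc (suc i)) j ∎)

  wave-symm : ∀ s t {z} → Wave (bond s t) z → Wave (bond t s) z
  wave-symm s t {z} = subst (λ e → Wave (cut e) z) (symm M s t)

  module _ {s t : Fin n} (s≢t : s ≢ t) (f : V) where

    private
      d = bond s t
      -- The sign makes (f s , f t) the pair (-z₀ , z₁) that alternating reflections shift.
      z = wave d (λ j → - f s j) (f t)
      w : Wave d z
      w i j = refl

    act-pow : ∀ k → act (pow s t k) f s ≐ (λ j → - z (k * 2) j)
                  × act (pow s t k) f t ≐ z (suc (k * 2))
    act-pow zero    = (λ j → sym (ℤ.neg-involutive (f s j))) , (λ j → refl)
    act-pow (suc k) =
      let (p , q)   = act-pow k
          (p′ , q′) = refl-act-wave (≢-sym s≢t) (wave-symm s t w) (k * 2) _ p q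
      in refl-act-wave s≢t w (suc (k * 2)) _ p′ q′

    -- In each factor s t, the letter t contributes an odd-numbered term of the wave and the letter
    -- s the next even one. Additivity of the operators collects them into two sums.
    act-pow-other : ∀ r → s ≢ r → t ≢ r → ∀ k → act (pow s t k) f r ≐
      λ j → f r j ⊕ (link t r (stepSum z 1 k) j ⊕ link s r (stepSum z 2 k) j)
    act-pow-other r s≢r t≢r zero j = sym (begin
      f r j ⊕ (link t r (λ _ → 0ℤ) j ⊕ link s r (λ _ → 0ℤ) j)
        ≡⟨ cong (f r j ⊕_) (cong₂ _⊕_ (path-0 (bond t r) j) (path-0 (bond s r) j)) ⟩
      f r j ⊕ 0ℤ
        ≡⟨ ℤ.+-identityʳ _ ⟩
      f r j ∎)
    act-pow-other r s≢r t≢r (suc k) j = begin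
      refl-act s (refl-act t g) r j
        ≡⟨ refl-act-other s r (refl-act t g) s≢r j ⟩
      refl-act t g r j ⊕ link s r (refl-act t g s) j
        ≡⟨ cong₂ _⊕_ (refl-act-other t r g t≢r j)
             (path-cong (bond s r) (λ i → trans (proj₂ step i) (cong (λ e → z e i) (sym (ℕ.+-comm (k * 2) 2)))) j) ⟩
      (g r j ⊕ link t r (g t) j) ⊕ link s r (z (k * 2 + 2)) j
        ≡⟨ cong (_⊕ link s r (z (k * 2 + 2)) j) (cong₂ _⊕_ (act-pow-other r s≢r t≢r k j)
             (path-cong (bond t r) (λ i → trans (proj₂ (act-pow k) i) (cong (λ e → z e i) (sym (ℕ.+-comm (k * 2) 1)))) j)) ⟩
      ((f r j ⊕ (T ⊕ S)) ⊕ link t r (z (k * 2 + 1)) j) ⊕ link s r (z (k * 2 + 2)) j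
        ≡⟨ regroup (f r j) T S _ _ ⟩
      f r j ⊕ ((T ⊕ link t r (z (k * 2 + 1)) j) ⊕ (S ⊕ link s r (z (k * 2 + 2)) j))
        ≡⟨ sym (cong (f r j ⊕_) (cong₂ _⊕_ (path-+ (bond t r) (stepSum z 1 k) (z (k * 2 + 1)) j)
                                           (path-+ (bond s r) (stepSum z 2 k) (z (k * 2 + 2)) j))) ⟩
      f r j ⊕ (link t r (stepSum z 1 (suc k)) j ⊕ link s r (stepSum z 2 (suc k)) j) ∎
      where
      g = act (pow s t k) f
      T = link t r (stepSum z 1 k) j
      S = link s r (stepSum z 2 k) j
      step = refl-act-wave (≢-sym s≢t) (wave-symm s t w) (k * 2) g (proj₁ (act-pow k)) (proj₂ (act-pow k))
      regroup : ∀ a b c e h → ((a ⊕ (b ⊕ c)) ⊕ e) ⊕ h ≡ a ⊕ ((b ⊕ e) ⊕ (c ⊕ h))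
      regroup = solve-∀

    -- With m = `2 + k`, the coordinates s and t return because the wave has period 2m, the others
    -- because sums of m alternate terms vanish.
    act-pow-trivial : ∀ k → d ≡ suc k → act (pow s t (2 + k)) f ≋ f
    act-pow-trivial k d≡ r = by-cases (s Fin.≟ r) (t Fin.≟ r)
      where
      w′ = subst (λ e → Wave e z) d≡ w
      by-cases : Dec (s ≡ r) → Dec (t ≡ r) → act (pow s t (2 + k)) f r ≐ f r
      by-cases (yes refl) _ j = begin
        act (pow s t (2 + k)) f s j  ≡⟨ proj₁ (act-pow (2 + k)) j ⟩
        - z ((2 + k) * 2) j          ≡⟨ cong (λ i → - z i j) (sym (ℕ.+-identityʳ ((2 + k) * 2))) ⟩
        - z ((2 + k) * 2 + 0) j      ≡⟨ cong -_ (wave-period k z w′ 0 j) ⟩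
        - (- f s j)                  ≡⟨ ℤ.neg-involutive (f s j) ⟩
        f s j ∎
      by-cases (no _) (yes refl) j = begin
        act (pow s t (2 + k)) f t j  ≡⟨ proj₂ (act-pow (2 + k)) j ⟩
        z (suc ((2 + k) * 2)) j      ≡⟨ cong (λ i → z i j) (ℕ.+-comm 1 ((2 + k) * 2)) ⟩
        z ((2 + k) * 2 + 1) j        ≡⟨ wave-period k z w′ 1 j ⟩
        f t j ∎
      by-cases (no s≢r) (no t≢r) j = begin
        act (pow s t (2 + k)) f r j
          ≡⟨ act-pow-other r s≢r t≢r (2 + k) j ⟩
        f r j ⊕ (link t r (stepSum z 1 (2 + k)) j ⊕ link s r (stepSum z 2 (2 + k)) j)
          ≡⟨ cong (f r j ⊕_) (cong₂ _⊕_
               (trans (path-cong (bond t r) (wave-sum k z w′ 1) j) (path-0 (bond t r) j))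
               (trans (path-cong (bond s r) (wave-sum k z w′ 2) j) (path-0 (bond s r) j))) ⟩
        f r j ⊕ 0ℤ
          ≡⟨ ℤ.+-identityʳ _ ⟩
        f r j ∎

  act-rel : ∀ s t k → m M s t ≡ fin k → ∀ f → act (pow s t k) f ≋ f
  act-rel s t k ms≡k f with s Fin.≟ t
  ... | yes refl with trans (sym ms≡k) (diag M s)
  ...   | refl = refl-act-invol s f
  act-rel s t k ms≡k f | no s≢t with off M s t s≢t k ms≡k
  ... | s≤s (s≤s {n = k′} z≤n) = act-pow-trivial s≢t f k′ (cong cut ms≡k)

  act-~ : ∀ {x y} → x ~ y → ∀ f → act x f ≋ act y f
  act-~ (rel {s} {t} {k} u w e) f r j = begin
    act (u ++ pow s t k ++ w) f r j
      ≡⟨ cong (λ g → g r j) (trans (act-++ u _ f) (cong (act u) (act-++ (pow s t k) w f))) ⟩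
    act u (act (pow s t k) (act w f)) r j
      ≡⟨ act-cong u (act-rel s t k e (act w f)) r j ⟩
    act u (act w f) r j
      ≡⟨ cong (λ g → g r j) (sym (act-++ u w f)) ⟩
    act (u ++ w) f r j ∎
  act-~ ~refl          f r j = refl
  act-~ (~sym p)       f r j = sym (act-~ p f r j)
  act-~ (~trans p q)   f r j = trans (act-~ p f r j) (act-~ q f r j)

  -- Alternating words and their action

  alt : Fin n → Fin n → ℕ → Word
  alt s t zero    = []
  alt s t (suc k) = s ∷ alt t s k

  data Below : ℕ → ℕ∞ → Set where
    <fin : ∀ {k l} → k < l → Below k (fin l)
    <∞   : ∀ {k} → Below k ∞

  below-inside : ∀ {k e} → Below (suc k) e → ∀ i → i < k → ¬ cut e ∣ suc (i + 0)
  below-inside (<fin (s≤s k<l)) i i<k =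
    inside-piece _ 0 i (_ ∣0) (ℕ.≤-<-trans i<k k<l)
  below-inside <∞ i i<k 0∣ with 0∣⇒≡0 0∣
  ... | ()

  private
    -- The swaps of s and t follow the letters of `alt s t k`, so the constant function 1 sits at
    -- the last letter of that word, or at t if the word is empty.
    pulse : Fin n → Fin n → ℕ → V
    pulse s t zero    r = if does (t Fin.≟ r) then (λ _ → 1ℤ) else (λ _ → 0ℤ)
    pulse s t (suc k) = pulse t s k

  module _ where
    private
      z : ∀ s t → ℕ → ℕ → ℤ
      z s t i = cheb (bond s t) i (λ _ → 1ℤ)
      w : ∀ s t → Wave (bond s t) (z s t)
      w s t i = cheb-step (bond s t) i _
      z-symm : ∀ s t i → z s t i ≡ z t s i
      z-symm s t i = cong (λ e → cheb (cut e) i (λ _ → 1ℤ)) (symm M s t)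

    act-pulse : ∀ {s t} → s ≢ t → ∀ k → act (alt s t k) (pulse s t k) s ≐ (λ j → - z s t k j)
                                      × act (alt s t k) (pulse s t k) t ≐ z s t (suc k)
    act-pulse {s} {t} s≢t zero with t Fin.≟ s | t Fin.≟ t
    ... | yes t≡s | _       = contradiction (sym t≡s) s≢t
    ... | no _    | no t≢t  = contradiction refl t≢t
    ... | no _    | yes _   = (λ j → refl) , (λ j → refl)
    act-pulse {s} {t} s≢t (suc k) =
      let (p , q) = act-pulse (≢-sym s≢t) k
      in refl-act-wave s≢t (w s t) k _
           (λ j → trans (p j) (cong (λ e → - e j) (z-symm t s k)))
           (λ j → trans (q j) (cong (λ e → e j) (z-symm t s (suc k))))

    -- The last letter of `alt t s (suc k)` is the one whose coordinate is 0, so it fixes the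
    -- vector, and the wave stays one step behind that of `act-pulse`.
    act-pulse-late : ∀ {s t} → s ≢ t → ∀ k →
      act (alt t s (suc k)) (pulse s t (suc k)) t ≐ (λ j → - z s t k j) ×
      act (alt t s (suc k)) (pulse s t (suc k)) s ≐ z s t (suc k)
    act-pulse-late {s} {t} s≢t zero =
      (λ j → trans (refl-act-same t (pulse t s 0) j) (cong -_ (at-t j))) ,
      (λ j → begin
        refl-act t (pulse t s 0) s j
          ≡⟨ refl-act-other t s _ (≢-sym s≢t) j ⟩
        pulse t s 0 s j ⊕ link t s (pulse t s 0 t) j
          ≡⟨ cong₂ _⊕_ (at-s j) (trans (path-cong (bond t s) at-t j) (path-0 (bond t s) j)) ⟩
        1ℤ ∎)
      where
      at-t : pulse t s 0 t ≐ λ _ → 0ℤ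
      at-t j with s Fin.≟ t
      ... | yes s≡t = contradiction s≡t s≢t
      ... | no _    = refl
      at-s : pulse t s 0 s ≐ λ _ → 1ℤ
      at-s j with s Fin.≟ s
      ... | yes _  = refl
      ... | no s≢s = contradiction refl s≢s
    act-pulse-late {s} {t} s≢t (suc k) =
      let (p , q) = act-pulse-late (≢-sym s≢t) k
      in refl-act-wave (≢-sym s≢t) (wave-symm s t (w s t)) k _
           (λ j → trans (p j) (cong (λ e → - e j) (z-symm t s k)))
           (λ j → trans (q j) (cong (λ e → e j) (z-symm t s (suc k))))

    -- The two sides send a suitable vector to vectors whose s-coordinates at 0 are −1 and 1.
    alt-distinct : ∀ {s t k} → s ≢ t → Below (suc k) (m M s t) → ¬ (alt s t (suc k) ~ alt t s (suc k))
    alt-distinct {s} {t} {k} s≢t below p with trans (sym minus) (trans equal plus)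
      where
      f = pulse s t (suc k)
      -- As k + 1 < m, the points 0, ..., k lie in one piece, and the constant 1 is read off at k.
      one : z s t (suc k) 0 ≡ 1ℤ
      one = cheb-eval (bond s t) 0 k (λ _ → 1ℤ) (_ ∣0) (below-inside below)
      equal : act (alt s t (suc k)) f s 0 ≡ act (alt t s (suc k)) f s 0
      equal = act-~ p f s 0
      minus : act (alt s t (suc k)) f s 0 ≡ - 1ℤ
      minus = trans (proj₁ (act-pulse s≢t (suc k)) 0) (cong -_ one)
      plus : act (alt t s (suc k)) f s 0 ≡ 1ℤ
      plus = trans (proj₂ (act-pulse-late s≢t k) 0) one
    ... | ()

-- Reflections and the exchange condition

-- The parity of the number of propositions that hold: a relation, since they need not be decidable.
data Parity : List Set → Bool → Set₁ where
  []   : Parity [] false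
  hit  : ∀ {P Ps b} → P → Parity Ps b → Parity (P ∷ Ps) (not b)
  miss : ∀ {P Ps b} → ¬ P → Parity Ps b → Parity (P ∷ Ps) b

infix 4 _⇔*_
_⇔*_ : List Set → List Set → Set₁
_⇔*_ = Pointwise λ P Q → P ⇔ Q

parity-unique : ∀ {Ps Qs b c} → Ps ⇔* Qs → Parity Ps b → Parity Qs c → b ≡ c
parity-unique []       []         []         = refl
parity-unique (e ∷ es) (hit p x)  (hit q y)  = cong not (parity-unique es x y)
parity-unique (e ∷ es) (hit p x)  (miss ¬q y) = contradiction (Equivalence.to e p) ¬q
parity-unique (e ∷ es) (miss ¬p x) (hit q y)  = contradiction (Equivalence.from e q) ¬p
parity-unique (e ∷ es) (miss _ x) (miss _ y) = parity-unique es x y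

-- Equality in W is not decided yet, so parities are available only under double negation. This
-- suffices for stable conclusions such as equations between Booleans.
parity-total : ∀ Ps → ¬ ¬ (∃ (Parity Ps))
parity-total []       k = k (false , [])
parity-total (P ∷ Ps) k = parity-total Ps λ (b , x) → ¬¬-excluded-middle λ where
  (yes p) → k (not b , hit p x)
  (no ¬p) → k (b , miss ¬p x)

parity-++ : ∀ {Ps Qs b c} → Parity Ps b → Parity Qs c → Parity (Ps ++ Qs) (b xor c)
parity-++ []         y = y
parity-++ {b = b} {c} (hit {b = b′} p x) y = subst (Parity _) (Bool.not-distribˡ-xor b′ c) (hit p (parity-++ x y))
parity-++ (miss ¬p x) y = miss ¬p (parity-++ x y)

odd⇒any : ∀ {Ps b} → Parity Ps b → b ≡ true → Any id Ps
odd⇒any (hit p _)  _   = here p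
odd⇒any (miss _ x) odd = there (odd⇒any x odd)

⇔*-refl : ∀ Ps → Ps ⇔* Ps
⇔*-refl []       = []
⇔*-refl (P ∷ Ps) = mk⇔ id id ∷ ⇔*-refl Ps

≡⇒⇔* : ∀ {Ps Qs} → Ps ≡ Qs → Ps ⇔* Qs
≡⇒⇔* refl = ⇔*-refl _

applyUpTo-+ : ∀ {A : Set₁} (f : ℕ → A) k l → applyUpTo f (k + l) ≡ applyUpTo f k ++ applyUpTo (λ i → f (k + i)) l
applyUpTo-+ f zero    l = refl
applyUpTo-+ f (suc k) l = cong (f 0 ∷_) (applyUpTo-+ (f ∘ suc) k l)

applyUpTo-⇔* : ∀ {f g : ℕ → Set} → (∀ i → f i ⇔ g i) → ∀ k → applyUpTo f k ⇔* applyUpTo g k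
applyUpTo-⇔* e zero    = []
applyUpTo-⇔* e (suc k) = e 0 ∷ applyUpTo-⇔* (e ∘ suc) k

⇔*-trans : ∀ {Ps Qs Rs} → Ps ⇔* Qs → Qs ⇔* Rs → Ps ⇔* Rs
⇔*-trans []       []       = []
⇔*-trans (e ∷ es) (f ∷ fs) =
  mk⇔ (Equivalence.to f ∘ Equivalence.to e) (Equivalence.from e ∘ Equivalence.from f) ∷ ⇔*-trans es fs

module CoxeterGroup {n : ℕ} (M : CoxeterMatrix n) where
  open Coxeter M
  open Representation M public

  -- Words as elements of the group W

  ≡⇒~ : ∀ {x y} → x ≡ y → x ~ y
  ≡⇒~ refl = ~refl

  ~-context : ∀ u w {x y} → x ~ y → u ++ x ++ w ~ u ++ y ++ w
  ~-context u w (rel {s} {t} {k} u′ w′ e) =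
    subst₂ _~_ (trans (List.++-assoc u u′ _) (cong (u ++_)
                 (trans (cong (u′ ++_) (sym (List.++-assoc (pow s t k) w′ w))) (sym (List.++-assoc u′ _ w)))))
               (trans (List.++-assoc u u′ _) (cong (u ++_) (sym (List.++-assoc u′ w′ w))))
               (rel (u ++ u′) (w′ ++ w) e)
  ~-context u w ~refl        = ~refl
  ~-context u w (~sym p)     = ~sym (~-context u w p)
  ~-context u w (~trans p q) = ~trans (~-context u w p) (~-context u w q)

  ++ˡ-cong : ∀ u {x y} → x ~ y → u ++ x ~ u ++ y
  ++ˡ-cong u {x} {y} p = subst₂ (λ a b → u ++ a ~ u ++ b) (List.++-identityʳ x) (List.++-identityʳ y) (~-context u [] p)

  ++-cong : ∀ {x y u w} → x ~ y → u ~ w → x ++ u ~ y ++ w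
  ++-cong {y = y} {u} p q = ~trans (~-context [] u p) (++ˡ-cong y q)

  ++ʳ-cong : ∀ u {x y} → x ~ y → x ++ u ~ y ++ u
  ++ʳ-cong u p = ++-cong p ~refl

  ∷-cong : ∀ s {x y} → x ~ y → s ∷ x ~ s ∷ y
  ∷-cong s = ++ˡ-cong [ s ]

  ss-cancel : ∀ s x → s ∷ s ∷ x ~ x
  ss-cancel s x = rel [] x (diag M s)

  inv-∷ : ∀ s x y → inv (s ∷ x) ++ y ≡ inv x ++ s ∷ y
  inv-∷ s x y = trans (cong (_++ y) (List.unfold-reverse s x)) (List.++-assoc (inv x) [ s ] y)

  inv-cancel : ∀ x y → inv x ++ x ++ y ~ y
  inv-cancel []      y = ~refl
  inv-cancel (s ∷ x) y = ~trans (≡⇒~ (inv-∷ s x (s ∷ x ++ y))) (~trans (++ˡ-cong (inv x) (ss-cancel s (x ++ y))) (inv-cancel x y))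

  inverseˡ : ∀ x → inv x ++ x ~ []
  inverseˡ x = subst (λ y → inv x ++ y ~ []) (List.++-identityʳ x) (inv-cancel x [])

  inverseʳ : ∀ x → x ++ inv x ~ []
  inverseʳ x = subst (λ y → y ++ inv x ~ []) (List.reverse-involutive x) (inverseˡ (inv x))

  inv-cong : ∀ {x y} → x ~ y → inv x ~ inv y
  inv-cong {x} {y} p = ~trans (≡⇒~ (sym (List.++-identityʳ (inv x))))
    (~trans (++ˡ-cong (inv x) (~trans (~sym (inverseʳ y)) (++ʳ-cong (inv y) (~sym p)))) (inv-cancel x (inv y)))

  group : Group 0ℓ 0ℓ
  group = record
    { Carrier = Word ; _≈_ = _~_ ; _∙_ = _++_ ; ε = [] ; _⁻¹ = inv
    ; isGroup = record
      { isMonoid = record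
        { isSemigroup = record
          { isMagma = record { isEquivalence = record { refl = ~refl ; sym = ~sym ; trans = ~trans } ; ∙-cong = ++-cong }
          ; assoc = λ x y z → ≡⇒~ (List.++-assoc x y z) }
        ; identity = (λ x → ~refl) , (λ x → ≡⇒~ (List.++-identityʳ x)) }
      ; inverse = inverseˡ , inverseʳ
      ; ⁻¹-cong = inv-cong } }

  open GroupProperties group public using (∙-cancelˡ; ∙-cancelʳ)
  open SetoidReasoning (Group.setoid group)

  ∷-cancel : ∀ s {x y} → s ∷ x ~ s ∷ y → x ~ y
  ∷-cancel s {x} {y} = ∙-cancelˡ [ s ] x y

  swap-∷ : ∀ s {x y} → s ∷ x ~ y → x ~ s ∷ y
  swap-∷ s {x} p = ~trans (~sym (ss-cancel s x)) (∷-cong s p)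

  -- Reflections of a word and the parity of their occurrences

  twist : Fin n → Word → Word
  twist s r = s ∷ r ++ [ s ]

  twist-cong : ∀ s {r r′} → r ~ r′ → twist s r ~ twist s r′
  twist-cong s p = ∷-cong s (++ʳ-cong [ s ] p)

  -- The i-th proposition says that r is the i-th reflection s₁⋯sᵢ⋯s₁ of the word s₁s₂⋯
  hits : Word → Word → List Set
  hits r []      = []
  hits r (s ∷ x) = (r ~ [ s ]) ∷ hits (twist s r) x

  -- The conjugate of r with which `hits` continues after the prefix x.
  conj : Word → Word → Word
  conj r []      = r
  conj r (s ∷ x) = conj (twist s r) x

  conj-spec : ∀ r x → conj r x ~ inv x ++ r ++ x
  conj-spec r []      = ≡⇒~ (sym (List.++-identityʳ r))
  conj-spec r (s ∷ x) = begin
    conj (twist s r) x             ≈⟨ conj-spec (twist s r) x ⟩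
    inv x ++ (s ∷ r ++ [ s ]) ++ x ≡⟨ cong (λ a → inv x ++ s ∷ a) (List.++-assoc r [ s ] x) ⟩
    inv x ++ s ∷ r ++ s ∷ x        ≡⟨ sym (inv-∷ s x (r ++ s ∷ x)) ⟩
    inv (s ∷ x) ++ r ++ s ∷ x      ∎

  hits-++ : ∀ r x y → hits r (x ++ y) ≡ hits r x ++ hits (conj r x) y
  hits-++ r []      y = refl
  hits-++ r (s ∷ x) y = cong ((r ~ [ s ]) ∷_) (hits-++ (twist s r) x y)

  hits-cong : ∀ {r r′} → r ~ r′ → ∀ x → hits r x ⇔* hits r′ x
  hits-cong p []      = []
  hits-cong p (s ∷ x) = mk⇔ (~trans (~sym p)) (~trans p) ∷ hits-cong (twist-cong s p) x

  alt-snoc : ∀ s t i → alt s t (suc (i * 2)) ++ [ t ] ≡ alt s t (suc (suc (i * 2)))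
  alt-snoc s t zero    = refl
  alt-snoc s t (suc i) = cong (λ x → s ∷ t ∷ x) (alt-snoc s t i)

  alt-pow : ∀ s t k l → alt s t (k * 2 + l) ≡ pow s t k ++ alt s t l
  alt-pow s t zero    l = refl
  alt-pow s t (suc k) l = cong (λ x → s ∷ t ∷ x) (alt-pow s t k l)

  alt-pow₀ : ∀ s t k → alt s t (k * 2) ≡ pow s t k
  alt-pow₀ s t zero    = refl
  alt-pow₀ s t (suc k) = cong (λ x → s ∷ t ∷ x) (alt-pow₀ s t k)

  -- Alternating words of odd length are palindromes, and conjugation by s lengthens one with first
  -- letter t at both ends.
  twist-alt : ∀ {r} s t i → twist s r ~ alt t s (suc (i * 2)) ⇔ r ~ alt s t (suc (suc i * 2))
  twist-alt {r} s t i = mk⇔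
    (λ p → begin
      r                                   ≈⟨ ~sym (twist-twist r) ⟩
      twist s (twist s r)                 ≈⟨ twist-cong s p ⟩
      s ∷ alt t s (suc (i * 2)) ++ [ s ]  ≡⟨ cong (s ∷_) (alt-snoc t s i) ⟩
      alt s t (suc (suc i * 2))           ∎)
    (λ p → begin
      twist s r                                   ≈⟨ twist-cong s p ⟩
      twist s (alt s t (suc (suc i * 2)))         ≡⟨ cong (λ x → twist s (s ∷ x)) (sym (alt-snoc t s i)) ⟩
      twist s (twist s (alt t s (suc (i * 2))))   ≈⟨ twist-twist _ ⟩
      alt t s (suc (i * 2))                       ∎)
    where
    twist-twist : ∀ r → twist s (twist s r) ~ r
    twist-twist r = begin
      s ∷ s ∷ (r ++ [ s ]) ++ [ s ]   ≈⟨ ss-cancel s _ ⟩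
      (r ++ [ s ]) ++ [ s ]           ≡⟨ List.++-assoc r [ s ] [ s ] ⟩
      r ++ s ∷ s ∷ []                 ≈⟨ ++ˡ-cong r (ss-cancel s []) ⟩
      r ++ []                         ≡⟨ List.++-identityʳ r ⟩
      r                               ∎

  hits-alt : ∀ r s t l → hits r (alt s t l) ⇔* applyUpTo (λ i → r ~ alt s t (suc (i * 2))) l
  hits-alt r s t zero    = []
  hits-alt r s t (suc l) = mk⇔ id id ∷ ⇔*-trans (hits-alt (twist s r) t s l) (applyUpTo-⇔* (twist-alt s t) l)

  -- The 2m reflections of (st)ᵐ come in two equal halves.
  hits-pow-even : ∀ r s t k → m M s t ≡ fin k → ∀ {b} → Parity (hits r (pow s t k)) b → b ≡ false
  hits-pow-even r s t k e {b} x = decidable-stable (b Bool.≟ false) λ ¬even →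
    parity-total (applyUpTo P k) λ (c , y) →
    parity-total (applyUpTo (λ i → P (k + i)) k) λ (c′ , y′) →
    ¬even (trans (parity-unique (hits-alt r s t (k * 2)) (subst (λ w → Parity (hits r w) b) (sym (alt-pow₀ s t k)) x)
                   (subst (λ Ps → Parity Ps (c xor c′)) (sym halves) (parity-++ y y′)))
                 (trans (cong (c xor_) (sym (parity-unique (applyUpTo-⇔* period k) y y′))) (Bool.xor-same c)))
    where
    P : ℕ → Set
    P i = r ~ alt s t (suc (i * 2))
    halves : applyUpTo P (k * 2) ≡ applyUpTo P k ++ applyUpTo (λ i → P (k + i)) k
    halves = trans (cong (applyUpTo P) (trans (ℕ.*-comm k 2) (cong (k +_) (ℕ.+-identityʳ k)))) (applyUpTo-+ P k k)
    shift : ∀ i → alt s t (suc ((k + i) * 2)) ~ alt s t (suc (i * 2))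
    shift i = begin
      alt s t (suc ((k + i) * 2))           ≡⟨ cong (alt s t) (trans (cong suc (ℕ.*-distribʳ-+ 2 k i))
                                                                         (sym (ℕ.+-suc (k * 2) (i * 2)))) ⟩
      alt s t (k * 2 + suc (i * 2))         ≡⟨ alt-pow s t k (suc (i * 2)) ⟩
      pow s t k ++ alt s t (suc (i * 2))    ≈⟨ rel [] _ e ⟩
      alt s t (suc (i * 2))                 ∎
    period : ∀ i → P i ⇔ P (k + i)
    period i = mk⇔ (λ p → ~trans p (~sym (shift i))) (λ p → ~trans p (shift i))

  conj-pow : ∀ r s t k → m M s t ≡ fin k → conj r (pow s t k) ~ r
  conj-pow r s t k e = begin
    conj r (pow s t k)                   ≈⟨ conj-spec r (pow s t k) ⟩
    inv (pow s t k) ++ r ++ pow s t k    ≈⟨ ++-cong (inv-cong trivial) (++ˡ-cong r trivial) ⟩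
    r ++ []                              ≡⟨ List.++-identityʳ r ⟩
    r                                    ∎
    where
    trivial : pow s t k ~ []
    trivial = subst (_~ []) (List.++-identityʳ _) (rel [] [] e)

  -- A relator contributes an even number of hits and, being trivial in W, leaves the later
  -- reflections unchanged. So the parity is an invariant of the element of W.
  hits-parity : ∀ {x y} → x ~ y → ∀ r {b c} → Parity (hits r x) b → Parity (hits r y) c → b ≡ c
  hits-parity (rel {s} {t} {k} u w e) r {b} {c} p q = decidable-stable (b Bool.≟ c) λ b≢c →
    parity-total (hits r u) λ (c₁ , x₁) →
    parity-total (hits (conj r u) (pow s t k)) λ (c₂ , x₂) →
    parity-total (hits (conj (conj r u) (pow s t k)) w) λ (c₃ , x₃) →
    parity-total (hits (conj r u) w) λ (c₄ , x₄) →
    let c₃≡c₄ = parity-unique (hits-cong (conj-pow (conj r u) s t k e) w) x₃ x₄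
        c₂≡0 = hits-pow-even (conj r u) s t k e x₂
        b≡ : b ≡ c₁ xor (c₂ xor c₃)
        b≡ = parity-unique (≡⇒⇔* (trans (hits-++ r u _) (cong (hits r u ++_) (hits-++ (conj r u) (pow s t k) w))))
               p (parity-++ x₁ (parity-++ x₂ x₃))
        c≡ : c ≡ c₁ xor c₄
        c≡ = parity-unique (≡⇒⇔* (hits-++ r u w)) q (parity-++ x₁ x₄)
    in b≢c (trans b≡ (trans (cong₂ (λ a a′ → c₁ xor (a xor a′)) c₂≡0 c₃≡c₄) (sym c≡)))
  hits-parity ~refl r p q = parity-unique (≡⇒⇔* refl) p q
  hits-parity (~sym e) r p q = sym (hits-parity e r q p)
  hits-parity (~trans {y = y} e e′) r {b} {c} p q = decidable-stable (b Bool.≟ c) λ b≢c →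
    parity-total (hits r y) λ (d , z) → b≢c (trans (hits-parity e r p z) (hits-parity e′ r z q))

  Deletion : Word → Word → Set
  Deletion x y = Σ Word λ p → Σ (Fin n) λ a → Σ Word λ q → x ≡ p ++ a ∷ q × y ~ p ++ q

  -- Multiplication by the reflection s₁⋯sᵢ⋯s₁ of a word s₁s₂⋯ cancels its i-th letter.
  any-hit⇒deletion : ∀ r x → Any id (hits r x) → Deletion x (r ++ x)
  any-hit⇒deletion r (s ∷ x) (here r~s) =
    [] , s , x , refl , ~trans (++ʳ-cong (s ∷ x) r~s) (ss-cancel s x)
  any-hit⇒deletion r (s ∷ x) (there h) with any-hit⇒deletion (twist s r) x h
  ... | p , a , q , refl , e = s ∷ p , a , q , refl ,
    swap-∷ s (~trans (≡⇒~ (cong (s ∷_) (sym (List.++-assoc r [ s ] x)))) e)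

  Reduced : Word → Set
  Reduced x = ∀ y → y ~ x → length x ≤ length y

  length-deletion : ∀ p a (q : Word) → length (p ++ a ∷ q) ≡ suc (length (p ++ q))
  length-deletion []      a q = refl
  length-deletion (_ ∷ p) a q = cong suc (length-deletion p a q)

  -- If s occurs an odd number of times among the reflections of x, a letter of x cancels. Otherwise
  -- it does so for s x, hence for y, and cancelling a letter of y leaves a word for x that is
  -- shorter than x.
  exchange : ∀ s {x y} → Reduced x → y ~ s ∷ x → length y ≤ length x → ¬ ¬ Deletion x (s ∷ x)
  exchange s {x} {y} red y~sx y≤x no-deletion =
    parity-total (hits [ s ] x) λ where
      (true  , p) → no-deletion (any-hit⇒deletion [ s ] x (odd⇒any p refl))
      (false , p) → parity-total (hits [ s ] y) λ (c , q) →
        parity-total (hits (twist s [ s ]) x) λ (b , p′) →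
          -- The first reflection of s x is s itself, and conjugation by s fixes s, so the remaining
          -- hits are those of x.
          let b≡0 = parity-unique (hits-cong (ss-cancel s [ s ]) x) p′ p
              c≡1 = trans (hits-parity y~sx [ s ] q (hit ~refl p′)) (cong not b≡0)
          in too-short (any-hit⇒deletion [ s ] y (odd⇒any q c≡1))
    where
    too-short : ¬ Deletion y (s ∷ y)
    too-short (p , a , q , refl , e) = ℕ.<-irrefl refl
      (ℕ.≤-trans (s≤s (red (p ++ q) (~trans (~sym e) (~sym (swap-∷ s (~sym y~sx))))))
        (subst (_≤ length x) (length-deletion p a q) y≤x))

-- Dihedral factors and the computation of lengths

module Length {n : ℕ} (M : CoxeterMatrix n) where
  open Coxeter M
  open CoxeterGroup M public

  -- Braid relations and alternating factors

  length-alt : ∀ s t k → length (alt s t k) ≡ k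
  length-alt s t zero    = refl
  length-alt s t (suc k) = cong suc (length-alt t s k)

  length-alt-++ : ∀ s t k z → length (alt s t k ++ z) ≡ k + length z
  length-alt-++ s t k z = trans (List.length-++ (alt s t k)) (cong (_+ length z) (length-alt s t k))

  -- The first i letters are moved to the other side one at a time; the two cases come from the
  -- parity of i.
  alt-shift : ∀ i l s t j → alt s t (i + l) ~ alt t s j →
              (alt s t l ~ alt t s (i + j)) ⊎ (alt t s l ~ alt s t (i + j))
  alt-shift zero    l s t j p = inj₁ p
  alt-shift (suc i) l s t j p with alt-shift i l t s (suc j) (swap-∷ s p)
  ... | inj₁ q = inj₂ (subst (λ h → alt t s l ~ alt s t h) (ℕ.+-suc i j) q)
  ... | inj₂ q = inj₁ (subst (λ h → alt s t l ~ alt t s h) (ℕ.+-suc i j) q)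

  -- Of the 2k letters of the trivial word (st)ᵏ, half are moved to the other side.
  alt-swap : ∀ {s t k} → m M s t ≡ fin k → alt s t k ~ alt t s k
  alt-swap {s} {t} {k} e with alt-shift k k s t 0 trivial
    where
    trivial : alt s t (k + k) ~ []
    trivial = subst (_~ []) (trans (List.++-identityʳ _) (trans (sym (alt-pow₀ s t k))
      (cong (alt s t) (trans (ℕ.*-comm k 2) (cong (k +_) (ℕ.+-identityʳ k)))))) (rel [] [] e)
  ... | inj₁ p = subst (λ h → alt s t k ~ alt t s h) (ℕ.+-identityʳ k) p
  ... | inj₂ p = ~sym (subst (λ h → alt t s k ~ alt s t h) (ℕ.+-identityʳ k) p)

  reduced-tail : ∀ {s x} → Reduced (s ∷ x) → Reduced x
  reduced-tail {s} red y y~x = ℕ.≤-pred (red (s ∷ y) (∷-cong s y~x))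

  reduced-resp : ∀ {x y} → x ~ y → length x ≡ length y → Reduced x → Reduced y
  reduced-resp x~y e red w w~y = subst (_≤ length w) e (red w (~trans w~y (~sym x~y)))

  LeftDescent : Fin n → Word → Set
  LeftDescent s x = Σ Word λ y → x ~ s ∷ y × length x ≡ suc (length y)

  left-descent-resp : ∀ {s x y} → x ~ y → length x ≡ length y → LeftDescent s x → LeftDescent s y
  left-descent-resp x~y e (w , p , q) = w , ~trans (~sym x~y) p , trans (sym e) q

  exchange-descent : ∀ s {x} → Reduced x → LeftDescent s x → ¬ ¬ Deletion x (s ∷ x)
  exchange-descent s {x} red (y , p , q) =
    exchange s red (swap-∷ s (~sym p)) (ℕ.≤-trans (ℕ.n≤1+n _) (ℕ.≤-reflexive (sym q)))

  split-++ : ∀ (u z p : Word) a q → u ++ z ≡ p ++ a ∷ q →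
    (Σ Word λ p′ → p ≡ u ++ p′ × z ≡ p′ ++ a ∷ q) ⊎ (Σ Word λ q′ → u ≡ p ++ a ∷ q′ × q ≡ q′ ++ z)
  split-++ []      z p       a q e    = inj₁ (p , refl , e)
  split-++ (b ∷ u) z []      a q refl = inj₂ (u , refl , refl)
  split-++ (b ∷ u) z (c ∷ p) a q e with List.∷-injective e
  ... | refl , e′ with split-++ u z p a q e′
  ...   | inj₁ (p′ , refl , e₂) = inj₁ (p′ , refl , e₂)
  ...   | inj₂ (q′ , refl , e₂) = inj₂ (q′ , refl , e₂)

  -- Once a is gone, its two neighbours are equal and adjacent, so they cancel. If a was the first
  -- letter, its left neighbour is the added t.
  alt-delete-inner : ∀ s t k p a b q → alt s t k ≡ p ++ a ∷ b ∷ q →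
    Σ Word λ y → t ∷ p ++ b ∷ q ~ y × k ≡ suc (suc (length y))
  alt-delete-inner s t (suc (suc k)) [] a b q refl =
    alt s t k , ss-cancel t _ , cong (suc ∘ suc) (sym (length-alt s t k))
  alt-delete-inner s t (suc k) (c ∷ p) a b q e with List.∷-injective e
  ... | refl , e′ with alt-delete-inner t s k p a b q e′
  ...   | y , r , l = t ∷ y , ∷-cong t r , cong suc l

  alt-delete-last : ∀ s t k p a → alt s t (suc k) ≡ p ++ [ a ] → p ≡ alt s t k
  alt-delete-last s t zero    []      a e = refl
  alt-delete-last s t zero    (c ∷ []) a ()
  alt-delete-last s t zero    (c ∷ _ ∷ p) a ()
  alt-delete-last s t (suc k) []      a ()
  alt-delete-last s t (suc k) (c ∷ p) a e with List.∷-injective e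
  ... | refl , e′ = cong (s ∷_) (alt-delete-last t s k p a e′)

  -- The exchange for t deletes one letter. In z, this yields the longer alternating factor. At the
  -- end of the alternating word, it would identify two words that `alt-distinct` separates; any
  -- earlier, it would give a shorter word for a reduced one.
  dihedral-step : ∀ {s t} k z → s ≢ t → Below (suc k) (m M s t) → Reduced (alt s t (suc k) ++ z) →
    LeftDescent t (alt s t (suc k) ++ z) →
    ¬ ¬ (Σ Word λ z′ → length z ≡ suc (length z′) × alt s t (suc k) ++ z ~ alt t s (suc (suc k)) ++ z′)
  dihedral-step {s} {t} k z s≢t below red ld none =
    exchange-descent t red ld λ (p , a , q , e , tx~pq) → cases p a q tx~pq (split-++ (alt s t (suc k)) z p a q e)
    where
    x = alt s t (suc k) ++ z
    cases : ∀ p a q → t ∷ x ~ p ++ q →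
      (Σ Word λ p′ → p ≡ alt s t (suc k) ++ p′ × z ≡ p′ ++ a ∷ q) ⊎
      (Σ Word λ q′ → alt s t (suc k) ≡ p ++ a ∷ q′ × q ≡ q′ ++ z) → ⊥
    cases p a q e (inj₁ (p′ , refl , refl)) = none (p′ ++ q , length-deletion p′ a q ,
      ~trans (swap-∷ t e) (≡⇒~ (cong (t ∷_) (List.++-assoc (alt s t (suc k)) p′ q))))
    cases p a q e (inj₂ ([] , u≡ , refl)) with alt-delete-last s t k p a u≡
    ... | refl = alt-distinct s≢t below (∙-cancelʳ z _ _ (swap-∷ t e))
    cases p a q e (inj₂ (b ∷ q′ , u≡ , refl)) with alt-delete-inner s t (suc k) p a b q′ u≡
    ... | y , r , l = ℕ.<-irrefl refl (ℕ.≤-<-trans (red (y ++ z) (~sym (~trans x~ (++ʳ-cong z r)))) (begin-strict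
        length (y ++ z)      ≡⟨ List.length-++ y ⟩
        length y + length z  <⟨ ℕ.+-monoˡ-< (length z) (subst (length y <_) (sym l) (ℕ.m≤n+m _ 1)) ⟩
        suc k + length z     ≡⟨ sym (length-alt-++ s t (suc k) z) ⟩
        length x             ∎))
      where
      open ℕ.≤-Reasoning
      x~ : x ~ (t ∷ p ++ b ∷ q′) ++ z
      x~ = ~trans (swap-∷ t e) (≡⇒~ (cong (t ∷_) (sym (List.++-assoc p (b ∷ q′) z))))

  AltFactor : Fin n → Fin n → ℕ → Word → Set
  AltFactor s t k x = Σ Word λ z → x ~ alt s t k ++ z × length x ≡ k + length z

  Dihedral : Fin n → Fin n → Word → Set
  Dihedral s t x = Σ ℕ λ k → m M s t ≡ fin k × AltFactor s t k x

  dihedral-swap : ∀ {s t x} → Dihedral s t x → Dihedral t s x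
  dihedral-swap {s} {t} (k , e , z , p , q) =
    k , trans (symm M t s) e , z , ~trans p (++ʳ-cong z (alt-swap e)) , q

  private
    AtMost : ℕ → ℕ∞ → Set
    AtMost j e = (e ≡ fin j) ⊎ Below j e

    at-most-suc : ∀ {j e} → Below j e → AtMost (suc j) e
    at-most-suc <∞ = inj₂ <∞
    at-most-suc {j} (<fin {l = l} j<l) with ℕ.m≤n⇒m<n∨m≡n j<l
    ... | inj₁ lt   = inj₂ (<fin lt)
    ... | inj₂ refl = inj₁ refl

    below-1 : ∀ {s t} → s ≢ t → Below 1 (m M s t)
    below-1 {s} {t} s≢t with m M s t in e
    ... | fin k = <fin (off M s t s≢t k e)
    ... | ∞     = <∞

    below-symm : ∀ {s t j} → AtMost j (m M s t) → AtMost j (m M t s)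
    below-symm {s} {t} {j} = subst (AtMost j) (symm M s t)

  -- The factor s is extended by `dihedral-step`, with s and t exchanging roles. Each step takes a
  -- letter from the rest of x, so the process ends, and it can only end at length m(s,t), which is
  -- therefore finite.
  dihedral : ∀ {s t x} → s ≢ t → Reduced x → LeftDescent s x → LeftDescent t x → ¬ ¬ Dihedral s t x
  dihedral {s} {t} {x} s≢t red (y , p , q) ldt =
    climb (length y) 0 s≢t (inj₂ (below-1 s≢t)) ldt′ ldt y p q refl
    where
    ldt′ : LeftDescent s x
    ldt′ = y , p , q
    climb : ∀ N j {a b} → a ≢ b → AtMost (suc j) (m M a b) → LeftDescent a x → LeftDescent b x →
      ∀ z → x ~ alt a b (suc j) ++ z → length x ≡ suc j + length z → length z ≡ N → ¬ ¬ Dihedral a b x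
    climb N j a≢b (inj₁ e) _ _ z p q _ none = none (suc j , e , z , p , q)
    climb N j {a} {b} a≢b (inj₂ below) lda ldb z p q lz none =
      let len = trans q (sym (length-alt-++ a b (suc j) z)) in
      dihedral-step j z a≢b below (reduced-resp p len red) (left-descent-resp p len ldb) λ where
        (z′ , l , r) → next N lz z′ l r
      where
      next : ∀ N → length z ≡ N → ∀ z′ → length z ≡ suc (length z′) →
        alt a b (suc j) ++ z ~ alt b a (suc (suc j)) ++ z′ → ⊥
      next zero     lz z′ l r = contradiction (trans (sym l) lz) λ ()
      next (suc N′) lz z′ l r = climb N′ (suc j) (≢-sym a≢b) (below-symm (at-most-suc below)) ldb lda z′ (~trans p r)
        (trans q (trans (cong (suc j +_) l) (ℕ.+-suc (suc j) (length z′)))) (ℕ.suc-injective (trans (sym l) lz))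
        (none ∘ dihedral-swap)

  -- Deciding left descents

  mutual
    -- If the first letter a is not s, then by `dihedral` s is a descent iff m(a,s) is finite and
    -- the tail has the alternating factor of length m(a,s) - 1 beginning with s. That factor is
    -- sought through descents of shorter words, whose lengths N bounds.
    leftDescent? : ∀ N s x → length x ≤ N → Reduced x → Dec (LeftDescent s x)
    leftDescent? N s [] _ _ = no λ ()
    leftDescent? (suc N) s (a ∷ x) (s≤s x≤N) red with a Fin.≟ s
    ... | yes refl = yes (x , ~refl , refl)
    ... | no a≢s with m M a s in e
    -- The conclusion is negative, so the double negation in `dihedral` does no harm.
    ...   | ∞ = no λ ld → dihedral a≢s red (x , ~refl , refl) ld λ (k , e′ , _) → contradiction (trans (sym e) e′) λ ()
    ...   | fin zero = contradiction (off M a s a≢s 0 e) λ ()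
    ...   | fin (suc k) with altFactor? N s a k x x≤N (reduced-tail red)
    ...     | yes (z , p , q) = yes (alt a s k ++ z ,
              ~trans (∷-cong a p) (++ʳ-cong z (alt-swap e)) ,
              cong suc (trans q (sym (length-alt-++ a s k z))))
    ...     | no ¬factor = no λ ld → dihedral a≢s red (x , ~refl , refl) ld (¬factor ∘ factor)
      where
      factor : Dihedral a s (a ∷ x) → AltFactor s a k x
      factor (k′ , e′ , z , p , q) with trans (sym e) e′
      ... | refl = z , ∷-cancel a p , ℕ.suc-injective q

    altFactor? : ∀ N s t k x → length x ≤ N → Reduced x → Dec (AltFactor s t k x)
    altFactor? N s t zero    x _   _   = yes (x , ~refl , refl)
    altFactor? N s t (suc k) x x≤N red with leftDescent? N s x x≤N red
    ... | no ¬ld = no λ (z , p , q) → ¬ld (alt t s k ++ z , p , trans q (cong suc (sym (length-alt-++ t s k z))))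
    ... | yes (y , p , q) = map′
      (λ (z , p′ , q′) → z , ~trans p (∷-cong s p′) , trans q (cong suc q′))
      (λ (z , p′ , q′) → z , ∷-cancel s (~trans (~sym p) p′) , ℕ.suc-injective (trans (sym q) q′))
      (altFactor? N t s k y (ℕ.≤-trans (ℕ.n≤1+n _) (subst (_≤ N) q x≤N))
        (reduced-tail (reduced-resp p q red)))

  -- A word for s x no longer than x would permit an exchange, and the deletion in x would exhibit s
  -- as a left descent.
  reduced-∷ : ∀ {s x} → Reduced x → ¬ LeftDescent s x → Reduced (s ∷ x)
  reduced-∷ {s} {x} red ¬ld w w~ with suc (length x) ≤? length w
  ... | yes le = le
  ... | no ¬le = ⊥-elim (exchange s red w~ (ℕ.≤-pred (ℕ.≰⇒> ¬le)) λ (p , a , q , e , r) →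
    ¬ld (p ++ q , swap-∷ s r , trans (cong length e) (length-deletion p a q)))

  opaque
    reduce : ∀ x → Σ Word λ y → y ~ x × Reduced y
    reduce []      = [] , ~refl , λ _ _ → z≤n
    reduce (s ∷ x) with reduce x
    ... | y , p , red with leftDescent? (length y) s y ℕ.≤-refl red
    ...   | yes (y′ , q , l) = y′ , ~trans (swap-∷ s (~sym q)) (∷-cong s p) , reduced-tail (reduced-resp q l red)
    ...   | no ¬ld           = s ∷ y , ∷-cong s p , reduced-∷ red ¬ld

  -- The length function

  nf : Word → Word
  nf x = proj₁ (reduce x)

  nf~ : ∀ x → nf x ~ x
  nf~ x = proj₁ (proj₂ (reduce x))

  nf-reduced : ∀ x → Reduced (nf x)
  nf-reduced x = proj₂ (proj₂ (reduce x))

  ℓ : Word → ℕ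
  ℓ x = length (nf x)

  ℓ-minimal : ∀ {x y} → y ~ x → ℓ x ≤ length y
  ℓ-minimal {x} y~x = nf-reduced x _ (~trans y~x (~sym (nf~ x)))

  ℓ-length : ∀ x → ℓ x ≤ length x
  ℓ-length x = ℓ-minimal ~refl

  ℓ-isLen : ∀ x → IsLen x (ℓ x)
  ℓ-isLen x = (nf x , nf~ x , refl) , λ y → ℓ-minimal

  isLen⇒ℓ : ∀ {x k} → IsLen x k → k ≡ ℓ x
  isLen⇒ℓ {x} ((y , p , refl) , min) = ℕ.≤-antisym (min _ (nf~ x)) (ℓ-minimal p)

  ℓ-cong : ∀ {x y} → x ~ y → ℓ x ≡ ℓ y
  ℓ-cong {x} {y} p = ℕ.≤-antisym (ℓ-minimal (~trans (nf~ y) (~sym p))) (ℓ-minimal (~trans (nf~ x) p))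

  ℓ-++ : ∀ x y → ℓ (x ++ y) ≤ ℓ x + ℓ y
  ℓ-++ x y = subst (ℓ (x ++ y) ≤_) (List.length-++ (nf x)) (ℓ-minimal (++-cong (nf~ x) (nf~ y)))

  ℓ-inv : ∀ x → ℓ (inv x) ≡ ℓ x
  ℓ-inv x = ℕ.≤-antisym (inv-≤ x) (subst (λ y → ℓ y ≤ ℓ (inv x)) (List.reverse-involutive x) (inv-≤ (inv x)))
    where
    inv-≤ : ∀ x → ℓ (inv x) ≤ ℓ x
    inv-≤ x = subst (ℓ (inv x) ≤_) (List.length-reverse (nf x)) (ℓ-minimal (inv-cong (nf~ x)))

  ℓ≡0⇒~[] : ∀ x → ℓ x ≡ 0 → x ~ []
  ℓ≡0⇒~[] x e = ~trans (~sym (nf~ x)) (≡⇒~ (empty (nf x) e))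
    where
    empty : ∀ (y : Word) → length y ≡ 0 → y ≡ []
    empty [] _ = refl

  Shortens : Fin n → Word → Set
  Shortens s x = ℓ x ≡ suc (ℓ (s ∷ x))

  shortens? : ∀ s x → Dec (Shortens s x)
  shortens? s x = ℓ x ℕ.≟ suc (ℓ (s ∷ x))

  opaque
    unfolding reduce

    -- The two outcomes are the two branches by which `reduce` treats the letter s.
    ℓ-∷ : ∀ s x → Shortens s x ⊎ (ℓ (s ∷ x) ≡ suc (ℓ x))
    ℓ-∷ s x with reduce x
    ... | y , p , red with leftDescent? (length y) s y ℕ.≤-refl red
    ...   | yes (y′ , q , l) = inj₁ l
    ...   | no ¬ld           = inj₂ refl

  ¬shortens⇒lengthens : ∀ {s x} → ¬ Shortens s x → ℓ (s ∷ x) ≡ suc (ℓ x)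
  ¬shortens⇒lengthens {s} {x} ¬sh with ℓ-∷ s x
  ... | inj₁ e = contradiction e ¬sh
  ... | inj₂ e = e

  lengthens⇒¬shortens : ∀ {s x} → ℓ (s ∷ x) ≡ suc (ℓ x) → ¬ Shortens s x
  lengthens⇒¬shortens e sh = ℕ.<-irrefl (trans sh (cong suc e)) (ℕ.m<n⇒m<1+n ℕ.≤-refl)

  ℓ≤⇒shortens : ∀ {s x} → ℓ (s ∷ x) ≤ ℓ x → Shortens s x
  ℓ≤⇒shortens {s} {x} le with ℓ-∷ s x
  ... | inj₁ e = e
  ... | inj₂ e = contradiction (subst (_≤ ℓ x) e le) ℕ.1+n≰n

  shortens-resp : ∀ {s x y} → x ~ y → Shortens s x → Shortens s y
  shortens-resp {s} p e = trans (ℓ-cong (~sym p)) (trans e (cong suc (ℓ-cong (∷-cong s p))))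

  shortens-both : ∀ {s t x} → s ≢ t → Shortens s x → Shortens t x →
    ¬ ¬ (Σ ℕ λ k → m M s t ≡ fin k × Σ Word λ z → x ~ alt s t k ++ z × ℓ x ≡ k + ℓ z)
  shortens-both {s} {t} {x} s≢t sh-s sh-t none =
    dihedral s≢t (nf-reduced x) (left-descent sh-s) (left-descent sh-t) λ (k , e , z , p , l) →
      let x~ = ~trans (~sym (nf~ x)) p in
      none (k , e , z , x~ , ℕ.≤-antisym
        (begin
          ℓ x                     ≡⟨ ℓ-cong x~ ⟩
          ℓ (alt s t k ++ z)      ≤⟨ ℓ-++ (alt s t k) z ⟩
          ℓ (alt s t k) + ℓ z     ≤⟨ ℕ.+-monoˡ-≤ (ℓ z) (ℓ-length (alt s t k)) ⟩
          length (alt s t k) + ℓ z ≡⟨ cong (_+ ℓ z) (length-alt s t k) ⟩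
          k + ℓ z                 ∎)
        (begin
          k + ℓ z       ≤⟨ ℕ.+-monoʳ-≤ k (ℓ-length z) ⟩
          k + length z  ≡⟨ sym l ⟩
          ℓ x           ∎))
    where
    open ℕ.≤-Reasoning
    left-descent : ∀ {s} → Shortens s x → LeftDescent s (nf x)
    left-descent {s} e = nf (s ∷ x) , ~trans (nf~ x) (swap-∷ s (~sym (nf~ (s ∷ x)))) , e

  Commute : Fin n → Fin n → Set
  Commute s t = s ≢ t × m M s t ≡ fin 2

  commute-∷ : ∀ {s t} → Commute s t → ∀ x → s ∷ t ∷ x ~ t ∷ s ∷ x
  commute-∷ (_ , e) x = ++ʳ-cong x (alt-swap e)

  -- By `shortens-both`, x begins with an alternating word of length m(s,t) = 2; removing s from s t
  -- leaves t in front.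
  shortens-commute : ∀ {s t x} → Commute s t → Shortens s x → Shortens t x → Shortens t (s ∷ x)
  shortens-commute {s} {t} {x} (s≢t , e) sh-s sh-t = decidable-stable (shortens? t (s ∷ x)) λ ¬sh →
    shortens-both s≢t sh-s sh-t λ (k , e′ , z , p , l) → ¬sh (two (trans (sym e) e′) p l)
    where
    two : ∀ {k z} → fin 2 ≡ fin k → x ~ alt s t k ++ z → ℓ x ≡ k + ℓ z → Shortens t (s ∷ x)
    two {z = z} refl p l = trans (ℕ.suc-injective (trans (sym sh-s) l))
      (cong suc (ℓ-cong (~sym (~trans (∷-cong t (~trans (∷-cong s p) (ss-cancel s (t ∷ z)))) (ss-cancel t z)))))

  -- Otherwise both s and t shorten s x, and `shortens-commute` makes t shorten s s x = x.
  lengthens-commute : ∀ {s t x} → Commute s t → ¬ Shortens s x → ¬ Shortens t x → ¬ Shortens t (s ∷ x)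
  lengthens-commute {s} {t} {x} c ¬s ¬t sh-t =
    ¬t (shortens-resp (ss-cancel s x) (shortens-commute c sh-s sh-t))
    where
    sh-s : Shortens s (s ∷ x)
    sh-s = trans (¬shortens⇒lengthens ¬s) (cong suc (ℓ-cong (~sym (ss-cancel s x))))

  generator-injective : ∀ {s t} → [ s ] ~ [ t ] → s ≡ t
  generator-injective {s} {t} p with s Fin.≟ t
  ... | yes e = e
  ... | no s≢t = ⊥-elim (alt-distinct {k = 0} s≢t (below-1 s≢t) p)

-- The weak order and commuting generators

module WeakOrder {n : ℕ} (M : CoxeterMatrix n) where
  open Coxeter M
  open Length M public

  ≤W⇒ℓ : ∀ {u w} → u ≤W w → ℓ w ≡ ℓ u + ℓ (inv u ++ w)
  ≤W⇒ℓ (a , b , la , lb , lw) = trans (sym (isLen⇒ℓ lw)) (cong₂ _+_ (isLen⇒ℓ la) (isLen⇒ℓ lb))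

  ℓ⇒≤W : ∀ {u w} → ℓ w ≡ ℓ u + ℓ (inv u ++ w) → u ≤W w
  ℓ⇒≤W {u} {w} e = ℓ u , ℓ (inv u ++ w) , ℓ-isLen u , ℓ-isLen _ , subst (IsLen w) e (ℓ-isLen w)

  factor⇒≤W : ∀ {u w} y → w ~ u ++ y → ℓ u + ℓ y ≤ ℓ w → u ≤W w
  factor⇒≤W {u} {w} y p le = ℓ⇒≤W (trans
    (ℕ.≤-antisym (ℕ.≤-trans (ℕ.≤-reflexive (ℓ-cong p)) (ℓ-++ u y)) le)
    (cong (ℓ u +_) (ℓ-cong (~sym (~trans (++ˡ-cong (inv u) p) (inv-cancel u y))))))

  cancel-inv : ∀ u w → u ++ inv u ++ w ~ w
  cancel-inv u w = ~trans (≡⇒~ (sym (List.++-assoc u (inv u) w))) (++ʳ-cong w (inverseʳ u))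

  ≤W-refl : ∀ {u w} → u ~ w → u ≤W w
  ≤W-refl {u} {w} p = factor⇒≤W [] (~trans (~sym p) (≡⇒~ (sym (List.++-identityʳ u))))
    (ℕ.≤-trans (ℕ.+-monoʳ-≤ (ℓ u) (ℓ-length []))
      (ℕ.≤-reflexive (trans (ℕ.+-identityʳ (ℓ u)) (ℓ-cong p))))

  ≤W⇒≤ : ∀ {u w} → u ≤W w → ℓ u ≤ ℓ w
  ≤W⇒≤ {u} le = subst (ℓ u ≤_) (sym (≤W⇒ℓ le)) (ℕ.m≤m+n _ _)

  ≤W-trans : ∀ {u v w} → u ≤W v → v ≤W w → u ≤W w
  ≤W-trans {u} {v} {w} p q = factor⇒≤W (inv u ++ w) (~sym (cancel-inv u w)) (begin
    ℓ u + ℓ (inv u ++ w)                                ≡⟨ cong (ℓ u +_) (ℓ-cong (++ˡ-cong (inv u) (~sym (cancel-inv v w)))) ⟩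
    ℓ u + ℓ (inv u ++ v ++ inv v ++ w)                  ≡⟨ cong (λ z → ℓ u + ℓ z) (sym (List.++-assoc (inv u) v _)) ⟩
    ℓ u + ℓ ((inv u ++ v) ++ inv v ++ w)                ≤⟨ ℕ.+-monoʳ-≤ (ℓ u) (ℓ-++ (inv u ++ v) _) ⟩
    ℓ u + (ℓ (inv u ++ v) + ℓ (inv v ++ w))             ≡⟨ sym (ℕ.+-assoc (ℓ u) _ _) ⟩
    ℓ u + ℓ (inv u ++ v) + ℓ (inv v ++ w)               ≡⟨ cong (_+ ℓ (inv v ++ w)) (sym (≤W⇒ℓ p)) ⟩
    ℓ v + ℓ (inv v ++ w)                                ≡⟨ sym (≤W⇒ℓ q) ⟩
    ℓ w                                                 ∎)
    where open ℕ.≤-Reasoning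

  ≤W-respˡ : ∀ {u v w} → u ~ v → u ≤W w → v ≤W w
  ≤W-respˡ p = ≤W-trans (≤W-refl (~sym p))

  ≤W-respʳ : ∀ {u v w} → v ~ w → u ≤W v → u ≤W w
  ≤W-respʳ p q = ≤W-trans q (≤W-refl p)

  ≤W∧ℓ≥⇒~ : ∀ {u w} → u ≤W w → ℓ w ≤ ℓ u → u ~ w
  ≤W∧ℓ≥⇒~ {u} {w} p le = ~trans (≡⇒~ (sym (List.++-identityʳ u)))
    (~trans (++ˡ-cong u (~sym (ℓ≡0⇒~[] (inv u ++ w) zero-gap))) (cancel-inv u w))
    where
    zero-gap : ℓ (inv u ++ w) ≡ 0
    zero-gap = ℕ.n≤0⇒n≡0 (ℕ.+-cancelˡ-≤ (ℓ u) _ 0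
      (subst₂ _≤_ (≤W⇒ℓ p) (sym (ℕ.+-identityʳ (ℓ u))) le))

  ≤W-antisym : ∀ {u w} → u ≤W w → w ≤W u → u ~ w
  ≤W-antisym p q = ≤W∧ℓ≥⇒~ p (≤W⇒≤ q)

  ≤W-covered : ∀ {u x w} → u ≤W x → x ≤W w → ℓ w ≡ suc (ℓ u) → (u ~ x) ⊎ (x ~ w)
  ≤W-covered {u} {x} {w} p q e with ℓ x ≤? ℓ u
  ... | yes le = inj₁ (≤W∧ℓ≥⇒~ p le)
  ... | no ¬le = inj₂ (≤W∧ℓ≥⇒~ q (subst (_≤ ℓ x) (sym e) (ℕ.≰⇒> ¬le)))

  Additive : Word → Word → Set
  Additive v x = ℓ (v ++ x) ≡ ℓ v + ℓ x

  ≤W⇒additive : ∀ {v w} → v ≤W w → Additive v (inv v ++ w)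
  ≤W⇒additive {v} {w} p = trans (ℓ-cong (cancel-inv v w)) (≤W⇒ℓ p)

  -- Subadditivity of the length gives the opposite inequalities, so lengths add along the whole
  -- chain from v through v a to v x.
  additive-factor : ∀ {v} a {b x} → Additive v x → x ~ a ++ b → length a + ℓ b ≤ ℓ x →
    ℓ (v ++ a) ≡ ℓ v + length a × v ≤W (v ++ a) × (v ++ a) ≤W (v ++ x)
  additive-factor {v} a {b} {x} add p le = len ,
    factor⇒≤W a ~refl (ℕ.≤-trans (ℕ.+-monoʳ-≤ (ℓ v) (ℓ-length a)) (ℕ.≤-reflexive (sym len))) ,
    factor⇒≤W b vx~ (begin
      ℓ (v ++ a) + ℓ b        ≡⟨ cong (_+ ℓ b) len ⟩
      ℓ v + length a + ℓ b    ≡⟨ ℕ.+-assoc (ℓ v) _ _ ⟩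
      ℓ v + (length a + ℓ b)  ≤⟨ ℕ.+-monoʳ-≤ (ℓ v) le ⟩
      ℓ v + ℓ x               ≡⟨ sym add ⟩
      ℓ (v ++ x)              ∎)
    where
    open ℕ.≤-Reasoning
    vx~ : v ++ x ~ (v ++ a) ++ b
    vx~ = ~trans (++ˡ-cong v p) (≡⇒~ (sym (List.++-assoc v a b)))
    len : ℓ (v ++ a) ≡ ℓ v + length a
    len = ℕ.≤-antisym (ℕ.≤-trans (ℓ-++ v a) (ℕ.+-monoʳ-≤ (ℓ v) (ℓ-length a)))
      (ℕ.+-cancelʳ-≤ (ℓ b) _ _ (begin
        ℓ v + length a + ℓ b    ≡⟨ ℕ.+-assoc (ℓ v) _ _ ⟩
        ℓ v + (length a + ℓ b)  ≤⟨ ℕ.+-monoʳ-≤ (ℓ v) le ⟩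
        ℓ v + ℓ x               ≡⟨ sym add ⟩
        ℓ (v ++ x)              ≡⟨ ℓ-cong vx~ ⟩
        ℓ ((v ++ a) ++ b)       ≤⟨ ℓ-++ (v ++ a) b ⟩
        ℓ (v ++ a) + ℓ b        ∎))

  -- Together with its converse `≤W⇒shortens`, this translates atoms below v x into left descents of
  -- x.
  shortens⇒≤W : ∀ {v s x} → Additive v x → Shortens s x →
    ℓ (v ++ [ s ]) ≡ suc (ℓ v) × v ≤W (v ++ [ s ]) × (v ++ [ s ]) ≤W (v ++ x)
  shortens⇒≤W {v} {s} {x} add sh =
    let (e , p , q) = additive-factor {v} [ s ] {s ∷ x} {x} add (~sym (ss-cancel s x)) (ℕ.≤-reflexive (sym sh))
    in trans e (ℕ.+-comm (ℓ v) 1) , p , q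

  ≤W⇒shortens : ∀ {v s x} → Additive v x → ℓ (v ++ [ s ]) ≡ suc (ℓ v) → (v ++ [ s ]) ≤W (v ++ x) → Shortens s x
  ≤W⇒shortens {v} {s} {x} add e p = ℕ.+-cancelˡ-≡ (ℓ v) _ _ (begin
    ℓ v + ℓ x                                        ≡⟨ sym add ⟩
    ℓ (v ++ x)                                       ≡⟨ ≤W⇒ℓ p ⟩
    ℓ (v ++ [ s ]) + ℓ (inv (v ++ [ s ]) ++ v ++ x)  ≡⟨ cong₂ _+_ e (ℓ-cong cancelled) ⟩
    suc (ℓ v) + ℓ (s ∷ x)                            ≡⟨ sym (ℕ.+-suc (ℓ v) _) ⟩
    ℓ v + suc (ℓ (s ∷ x))                            ∎)
    where
    open ≡-Reasoning
    cancelled : inv (v ++ [ s ]) ++ v ++ x ~ s ∷ x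
    cancelled = ~trans (≡⇒~ (cong (_++ v ++ x) (List.reverse-++ v [ s ]))) (∷-cong s (inv-cancel v x))

  IsAscent : Word → Fin n → Set
  IsAscent v s = ℓ (v ++ [ s ]) ≡ suc (ℓ v)

  ℓ-snoc : ∀ v s → ℓ (v ++ [ s ]) ≡ ℓ (s ∷ inv v)
  ℓ-snoc v s = trans (sym (ℓ-inv (v ++ [ s ]))) (cong ℓ (List.reverse-++ v [ s ]))

  ascent⇒¬shortens : ∀ {v s} → IsAscent v s → ¬ Shortens s (inv v)
  ascent⇒¬shortens {v} {s} e = lengthens⇒¬shortens (trans (sym (ℓ-snoc v s)) (trans e (cong suc (sym (ℓ-inv v)))))

  ¬shortens⇒ascent : ∀ {v s} → ¬ Shortens s (inv v) → IsAscent v s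
  ¬shortens⇒ascent {v} {s} ¬sh = trans (ℓ-snoc v s) (trans (¬shortens⇒lengthens ¬sh) (cong suc (ℓ-inv v)))

  ¬Des⇒ascent : ∀ {v s} → ¬ Des v s → IsAscent v s
  ¬Des⇒ascent {v} {s} ¬des = ¬shortens⇒ascent {v} {s} λ sh →
    ¬des (ℓ (v ++ [ s ]) , ℓ-isLen _ , subst (IsLen v)
      (trans (sym (ℓ-inv v)) (trans sh (cong suc (sym (ℓ-snoc v s))))) (ℓ-isLen v))

  ascent⇒¬Des : ∀ {v s} → IsAscent v s → ¬ Des v s
  ascent⇒¬Des {v} {s} e (k , l , l′) =
    ℕ.<-irrefl (trans (isLen⇒ℓ l) (trans e (cong suc (sym (isLen⇒ℓ l′))))) (ℕ.m<n⇒m<1+n ℕ.≤-refl)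

  -- Products of commuting generators

  Commuting : List (Fin n) → Set
  Commuting = AllPairs Commute

  ascent-[] : ∀ s → IsAscent [] s
  ascent-[] s = ¬shortens⇒ascent {[]} λ sh → contradiction (trans (sym sh) (ℕ.n≤0⇒n≡0 (ℓ-length []))) λ ()

  -- By `lengthens-commute`, the remaining letters are still ascents after s has been appended.
  ℓ-ascents : ∀ L v → Commuting L → All (IsAscent v) L → ℓ (v ++ L) ≡ ℓ v + length L
  ℓ-ascents []      v _        _        = trans (cong ℓ (List.++-identityʳ v)) (sym (ℕ.+-identityʳ (ℓ v)))
  ℓ-ascents (s ∷ L) v (c ∷ cs) (a ∷ as) = begin
    ℓ (v ++ s ∷ L)               ≡⟨ cong ℓ (sym (List.++-assoc v [ s ] L)) ⟩
    ℓ ((v ++ [ s ]) ++ L)        ≡⟨ ℓ-ascents L (v ++ [ s ]) cs (All.zipWith (λ (c , a′) → still c a′) (c , as)) ⟩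
    ℓ (v ++ [ s ]) + length L    ≡⟨ cong (_+ length L) a ⟩
    suc (ℓ v) + length L         ≡⟨ sym (ℕ.+-suc (ℓ v) (length L)) ⟩
    ℓ v + suc (length L)         ∎
    where
    open ≡-Reasoning
    still : ∀ {t} → Commute s t → IsAscent v t → IsAscent (v ++ [ s ]) t
    still {t} c a′ = ¬shortens⇒ascent {v ++ [ s ]} λ sh →
      lengthens-commute c (ascent⇒¬shortens {v} a) (ascent⇒¬shortens {v} a′)
        (subst (Shortens t) (List.reverse-++ v [ s ]) sh)

  ℓ-commuting : ∀ {L} → Commuting L → ℓ L ≡ length L
  ℓ-commuting {L} c = trans (ℓ-ascents L [] c (All.tabulate λ {s} _ → ascent-[] s))
    (cong (_+ length L) (ℕ.n≤0⇒n≡0 (ℓ-length [])))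

  -- By `shortens-commute`, the remaining letters still shorten once s has been removed.
  ℓ-shortening : ∀ L x → Commuting L → All (λ s → Shortens s x) L → ℓ x ≡ length L + ℓ (inv L ++ x)
  ℓ-shortening []      x _        _        = refl
  ℓ-shortening (s ∷ L) x (c ∷ cs) (a ∷ as) = trans a (cong suc (trans
    (ℓ-shortening L (s ∷ x) cs (All.zipWith (λ (c , a′) → shortens-commute c a a′) (c , as)))
    (cong (λ y → length L + ℓ y) (sym (inv-∷ s L x)))))

  commute-past : ∀ {s} K z → All (Commute s) K → s ∷ K ++ z ~ K ++ s ∷ z
  commute-past []      z []       = ~refl
  commute-past (t ∷ K) z (c ∷ cs) = ~trans (commute-∷ c (K ++ z)) (∷-cong t (commute-past K z cs))

  extract : ∀ {s L} → Commuting L → s ∈ L → Σ Word λ K → L ~ s ∷ K × length L ≡ suc (length K)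
  extract {L = t ∷ L} _        (here refl) = L , ~refl , refl
  extract {L = t ∷ L} (c ∷ cs) (there s∈L) with extract cs s∈L
  ... | K , p , l = t ∷ K , ~trans (∷-cong t p) (commute-∷ (All.lookup c s∈L) K) , cong suc l

  sublist : ∀ (L : List (Fin n)) → Subset (length L) → List (Fin n)
  sublist []      []          = []
  sublist (s ∷ L) (true  ∷ A) = s ∷ sublist L A
  sublist (s ∷ L) (false ∷ A) = sublist L A

  sublist-All : ∀ {P : Fin n → Set} L A → All P L → All P (sublist L A)
  sublist-All []      []          []       = []
  sublist-All (s ∷ L) (true  ∷ A) (p ∷ ps) = p ∷ sublist-All L A ps
  sublist-All (s ∷ L) (false ∷ A) (p ∷ ps) = sublist-All L A ps

  sublist-commuting : ∀ L A → Commuting L → Commuting (sublist L A)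
  sublist-commuting []      []          []       = []
  sublist-commuting (s ∷ L) (true  ∷ A) (c ∷ cs) = sublist-All L A c ∷ sublist-commuting L A cs
  sublist-commuting (s ∷ L) (false ∷ A) (c ∷ cs) = sublist-commuting L A cs

  sublist-⊥ : ∀ L → sublist L Subset.⊥ ≡ []
  sublist-⊥ []      = refl
  sublist-⊥ (s ∷ L) = sublist-⊥ L

  sublist-⊤ : ∀ L → sublist L Subset.⊤ ≡ L
  sublist-⊤ []      = refl
  sublist-⊤ (s ∷ L) = cong (s ∷_) (sublist-⊤ L)

  sublist-∈ : ∀ L A {s} → s ∈ sublist L A → s ∈ L
  sublist-∈ []      []          ()
  sublist-∈ (s ∷ L) (true  ∷ A) (here e)  = here e
  sublist-∈ (s ∷ L) (true  ∷ A) (there p) = there (sublist-∈ L A p)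
  sublist-∈ (s ∷ L) (false ∷ A) p         = there (sublist-∈ L A p)

  ∈⇒lookup∈sublist : ∀ L A i → i ∈ˢ A → lookup L i ∈ sublist L A
  ∈⇒lookup∈sublist (s ∷ L) (true  ∷ A) Fin.zero    here      = here refl
  ∈⇒lookup∈sublist (s ∷ L) (true  ∷ A) (Fin.suc i) (there p) = there (∈⇒lookup∈sublist L A i p)
  ∈⇒lookup∈sublist (s ∷ L) (false ∷ A) (Fin.suc i) (there p) = ∈⇒lookup∈sublist L A i p

  lookup∈sublist⇒∈ : ∀ L A i → Commuting L → lookup L i ∈ sublist L A → i ∈ˢ A
  lookup∈sublist⇒∈ (s ∷ L) (true  ∷ A) Fin.zero    _        _         = here
  lookup∈sublist⇒∈ (s ∷ L) (false ∷ A) Fin.zero    (c ∷ cs) p         =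
    contradiction refl (proj₁ (All.lookup c (sublist-∈ L A p)))
  lookup∈sublist⇒∈ (s ∷ L) (true  ∷ A) (Fin.suc i) (c ∷ cs) (here e)  =
    contradiction (sym e) (proj₁ (All.lookup c (∈-lookup i)))
  lookup∈sublist⇒∈ (s ∷ L) (true  ∷ A) (Fin.suc i) (c ∷ cs) (there p) = there (lookup∈sublist⇒∈ L A i cs p)
  lookup∈sublist⇒∈ (s ∷ L) (false ∷ A) (Fin.suc i) (c ∷ cs) p         = there (lookup∈sublist⇒∈ L A i cs p)

  -- D is the set of elements of B outside A; its letters are moved to the end, past those of A.
  sublist-⊆ : ∀ L A B → Commuting L → A ⊆ B → Σ (Subset (length L)) λ D →
    sublist L B ~ sublist L A ++ sublist L D × length (sublist L B) ≡ length (sublist L A) + length (sublist L D)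
  sublist-⊆ []      []          []          _        _   = [] , ~refl , refl
  sublist-⊆ (s ∷ L) (true  ∷ A) (true  ∷ B) (c ∷ cs) A⊆B with sublist-⊆ L A B cs (Subset.drop-∷-⊆ A⊆B)
  ... | D , p , l = false ∷ D , ∷-cong s p , cong suc l
  sublist-⊆ (s ∷ L) (true  ∷ A) (false ∷ B) (c ∷ cs) A⊆B = contradiction (A⊆B here) λ ()
  sublist-⊆ (s ∷ L) (false ∷ A) (true  ∷ B) (c ∷ cs) A⊆B with sublist-⊆ L A B cs (Subset.drop-∷-⊆ A⊆B)
  ... | D , p , l = true ∷ D , ~trans (∷-cong s p) (commute-past (sublist L A) (sublist L D) (sublist-All L A c)) ,
    trans (cong suc l) (sym (ℕ.+-suc _ _))
  sublist-⊆ (s ∷ L) (false ∷ A) (false ∷ B) (c ∷ cs) A⊆B with sublist-⊆ L A B cs (Subset.drop-∷-⊆ A⊆B)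
  ... | D , p , l = false ∷ D , p , l

  -- If s shortens y y′ (lengths adding) but not y, then the exchange takes place in y′.
  exchange-right : ∀ {s z} y y′ → s ∷ z ~ y ++ y′ → ℓ (s ∷ z) ≡ ℓ y + ℓ y′ → ℓ (s ∷ z) ≡ suc (ℓ z) →
    ¬ Shortens s y → ℓ y + ℓ (inv y ++ z) ≤ ℓ z
  exchange-right {s} {z} y y′ p add e ¬sh = decidable-stable (_ ≤? _) λ ¬le →
    exchange s red (~trans (nf~ z) (~trans (swap-∷ s p) (∷-cong s (~sym Y~)))) short λ (p′ , a , q , eq , r) →
    cases ¬le p′ a q r (split-++ (nf y) (nf y′) p′ a q eq)
    where
    open ℕ.≤-Reasoning
    Y = nf y ++ nf y′
    Y~ : Y ~ y ++ y′
    Y~ = ++-cong (nf~ y) (nf~ y′)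
    len : length Y ≡ ℓ (s ∷ z)
    len = trans (List.length-++ (nf y)) (sym add)
    red : Reduced Y
    red w w~ = subst (_≤ length w) (sym len) (ℓ-minimal (~trans w~ (~trans Y~ (~sym p))))
    short : ℓ z ≤ length Y
    short = ℕ.≤-trans (ℕ.n≤1+n _) (ℕ.≤-reflexive (trans (sym e) (sym len)))
    cases : ¬ (ℓ y + ℓ (inv y ++ z) ≤ ℓ z) → ∀ p′ a q → s ∷ Y ~ p′ ++ q →
      (Σ Word λ p″ → p′ ≡ nf y ++ p″ × nf y′ ≡ p″ ++ a ∷ q) ⊎
      (Σ Word λ q″ → nf y ≡ p′ ++ a ∷ q″ × q ≡ q″ ++ nf y′) → ⊥
    cases ¬le _ a q r (inj₁ (p″ , refl , eq)) = ¬le (ℕ.≤-pred (begin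
      suc (ℓ y + ℓ (inv y ++ z))         ≡⟨ sym (ℕ.+-suc (ℓ y) _) ⟩
      ℓ y + suc (ℓ (inv y ++ z))         ≤⟨ ℕ.+-monoʳ-≤ (ℓ y) (s≤s (ℓ-minimal (~sym rest))) ⟩
      ℓ y + suc (length (p″ ++ q))       ≡⟨ cong (ℓ y +_) (trans (sym (length-deletion p″ a q)) (cong length (sym eq))) ⟩
      ℓ y + ℓ y′                         ≡⟨ sym add ⟩
      ℓ (s ∷ z)                          ≡⟨ e ⟩
      suc (ℓ z)                          ∎))
      where
      rest : inv y ++ z ~ p″ ++ q
      rest = ~trans (++ˡ-cong (inv y) (~trans (swap-∷ s p) (~trans (∷-cong s (~sym Y~))
        (~trans r (~trans (≡⇒~ (List.++-assoc (nf y) p″ q)) (++ʳ-cong (p″ ++ q) (nf~ y)))))))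
        (inv-cancel y (p″ ++ q))
    cases _ p′ a _ r (inj₂ (q″ , eq , refl)) = ¬sh (ℓ≤⇒shortens (begin
      ℓ (s ∷ y)                 ≤⟨ ℓ-minimal (~sym (~trans (∷-cong s (~sym (nf~ y))) sy~)) ⟩
      length (p′ ++ q″)         ≤⟨ ℕ.n≤1+n _ ⟩
      suc (length (p′ ++ q″))   ≡⟨ sym (length-deletion p′ a q″) ⟩
      length (p′ ++ a ∷ q″)     ≡⟨ cong length (sym eq) ⟩
      ℓ y                       ∎))
      where
      sy~ : s ∷ nf y ~ p′ ++ q″
      sy~ = ∙-cancelʳ (nf y′) (s ∷ nf y) (p′ ++ q″) (~trans r (≡⇒~ (sym (List.++-assoc p′ q″ (nf y′)))))

  -- If s shortens y, it is chosen and removed from both sides. If not, `exchange-right` makes y a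
  -- prefix of the product of the remaining letters.
  prefix-of-commuting : ∀ L y y′ → Commuting L → L ~ y ++ y′ → length L ≡ ℓ y + ℓ y′ →
    Σ (Subset (length L)) λ A → y ~ sublist L A
  prefix-of-commuting []      y y′ _ p l = [] , ℓ≡0⇒~[] y (ℕ.m+n≡0⇒m≡0 (ℓ y) (sym l))
  prefix-of-commuting (s ∷ L) y y′ (c ∷ cs) p l with shortens? s y
  ... | yes sh = let (A , q) = prefix-of-commuting L (s ∷ y) y′ cs (swap-∷ s p) (ℕ.suc-injective (trans l (cong (_+ ℓ y′) sh)))
                 in true ∷ A , swap-∷ s q
  ... | no ¬sh = let (A , q) = prefix-of-commuting L y (inv y ++ L) cs (~sym (cancel-inv y L)) len in false ∷ A , q
    where
    lenL = ℓ-commuting cs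
    lensL = ℓ-commuting (c ∷ cs)
    len : length L ≡ ℓ y + ℓ (inv y ++ L)
    len = ℕ.≤-antisym
      (subst (_≤ ℓ y + ℓ (inv y ++ L)) (trans (ℓ-cong (cancel-inv y L)) lenL) (ℓ-++ y (inv y ++ L)))
      (subst (ℓ y + ℓ (inv y ++ L) ≤_) lenL
        (exchange-right y y′ p (trans lensL l) (trans lensL (cong suc (sym lenL))) ¬sh))

  -- A left descent is a prefix of length 1, hence a subproduct with a single letter, and distinct
  -- generators are distinct in W.
  shortens⇒∈ : ∀ {s L} → Commuting L → Shortens s L → s ∈ L
  shortens⇒∈ {s} {L} cs sh
    with prefix-of-commuting L [ s ] (s ∷ L) cs (~sym (ss-cancel s L))
           (trans (sym (ℓ-commuting cs)) (trans sh (cong (_+ ℓ (s ∷ L)) (sym (ℓ-commuting ([] ∷ []))))))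
  ... | A , p = single (sublist L A)
    (trans (sym (ℓ-commuting (sublist-commuting L A cs))) (trans (ℓ-cong (~sym p)) (ℓ-commuting ([] ∷ []))))
    p (sublist-∈ L A)
    where
    single : ∀ K → length K ≡ 1 → [ s ] ~ K → (∀ {t} → t ∈ K → t ∈ L) → s ∈ L
    single (t ∷ []) _ q sub with generator-injective q
    ... | refl = sub (here refl)

  ∈⇒shortens : ∀ {s L} → Commuting L → s ∈ L → Shortens s L
  ∈⇒shortens {s} {L} cs s∈L with extract cs s∈L
  ... | K , p , l = ℓ≤⇒shortens (begin
    ℓ (s ∷ L)        ≤⟨ ℓ-minimal (~sym (~trans (∷-cong s p) (ss-cancel s K))) ⟩
    length K         ≤⟨ ℕ.n≤1+n _ ⟩
    suc (length K)   ≡⟨ sym l ⟩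
    length L         ≡⟨ sym (ℓ-commuting cs) ⟩
    ℓ L              ∎)
    where open ℕ.≤-Reasoning

-- Boolean intervals

module BooleanIntervals {n : ℕ} (M : CoxeterMatrix n) where
  open Coxeter M
  open WeakOrder M

  module _ {v : Word} {L : List (Fin n)} (comm : Commuting L) (asc : All (IsAscent v) L) where

    private
      f : Subset (length L) → Word
      f A = v ++ sublist L A

      f-length : ∀ A → ℓ (f A) ≡ ℓ v + length (sublist L A)
      f-length A = ℓ-ascents (sublist L A) v (sublist-commuting L A comm) (sublist-All L A asc)

      f-additive : ∀ A → Additive v (sublist L A)
      f-additive A = trans (f-length A) (cong (ℓ v +_) (sym (ℓ-commuting (sublist-commuting L A comm))))

      f-⊥ : f Subset.⊥ ~ v
      f-⊥ = ≡⇒~ (trans (cong (v ++_) (sublist-⊥ L)) (List.++-identityʳ v))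

      f-⊤ : f Subset.⊤ ~ v ++ L
      f-⊤ = ≡⇒~ (cong (v ++_) (sublist-⊤ L))

      f-mono : ∀ A B → A ⊆ B → f A ≤W f B
      f-mono A B A⊆B with sublist-⊆ L A B comm A⊆B
      ... | D , p , l = factor⇒≤W (sublist L D) (~trans (++ˡ-cong v p) (≡⇒~ (sym (List.++-assoc v _ _)))) (begin
        ℓ (f A) + ℓ (sublist L D)                                ≤⟨ ℕ.+-monoʳ-≤ (ℓ (f A)) (ℓ-length _) ⟩
        ℓ (f A) + length (sublist L D)                           ≡⟨ cong (_+ length (sublist L D)) (f-length A) ⟩
        ℓ v + length (sublist L A) + length (sublist L D)        ≡⟨ ℕ.+-assoc (ℓ v) _ _ ⟩
        ℓ v + (length (sublist L A) + length (sublist L D))      ≡⟨ cong (ℓ v +_) (sym l) ⟩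
        ℓ v + length (sublist L B)                               ≡⟨ sym (f-length B) ⟩
        ℓ (f B)                                                  ∎)
        where open ℕ.≤-Reasoning

      -- A subset is recovered from its element: its letters are the s for which v s lies below.
      f-reflects : ∀ A B → f A ≤W f B → A ⊆ B
      f-reflects A B p {i} i∈A =
        let s∈A = ∈⇒lookup∈sublist L A i i∈A
            (a , _ , q) = shortens⇒≤W {v} (f-additive A) (∈⇒shortens (sublist-commuting L A comm) s∈A)
            sh = ≤W⇒shortens {v} (f-additive B) a (≤W-trans q p)
        in lookup∈sublist⇒∈ L B i comm (shortens⇒∈ (sublist-commuting L B comm) sh)

    ≤W-commuting : v ≤W (v ++ L)
    ≤W-commuting = ≤W-respˡ f-⊥ (≤W-respʳ f-⊤ (f-mono _ _ Subset.⊥⊆))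

    boolean-commuting : BooleanInterval v (v ++ L)
    boolean-commuting = length L , f ,
      (λ A → ≤W-respˡ f-⊥ (f-mono _ A Subset.⊥⊆) , ≤W-respʳ f-⊤ (f-mono A _ Subset.⊆⊤)) ,
      (λ A B p → Subset.⊆-antisym (f-reflects A B (≤W-refl p)) (f-reflects B A (≤W-refl (~sym p)))) ,
      onto ,
      (λ A B → mk⇔ (f-mono A B) (f-reflects A B))
      where
      onto : ∀ x → v ≤W x → x ≤W (v ++ L) → Σ (Subset (length L)) λ A → x ~ f A
      onto x p q =
        -- Lengths add along v ≤ x ≤ v L, so v⁻¹x is a prefix of the product of L.
        let (A , r) = prefix-of-commuting L (inv v ++ x) (inv x ++ v ++ L) comm
              (~sym (~trans (≡⇒~ (List.++-assoc (inv v) x _))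
                (~trans (++ˡ-cong (inv v) (cancel-inv x (v ++ L))) (inv-cancel v L)))) len
        in A , ~trans (~sym (cancel-inv v x)) (++ˡ-cong v r)
        where
        open ≡-Reasoning
        len : length L ≡ ℓ (inv v ++ x) + ℓ (inv x ++ v ++ L)
        len = ℕ.+-cancelˡ-≡ (ℓ v) _ _ (begin
          ℓ v + length L                                     ≡⟨ sym (ℓ-ascents L v comm asc) ⟩
          ℓ (v ++ L)                                         ≡⟨ ≤W⇒ℓ q ⟩
          ℓ x + ℓ (inv x ++ v ++ L)                          ≡⟨ cong (_+ ℓ (inv x ++ v ++ L)) (≤W⇒ℓ p) ⟩
          ℓ v + ℓ (inv v ++ x) + ℓ (inv x ++ v ++ L)         ≡⟨ ℕ.+-assoc (ℓ v) _ _ ⟩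
          ℓ v + (ℓ (inv v ++ x) + ℓ (inv x ++ v ++ L))       ∎)

    atoms-commuting : ∀ {s} → IsAscent v s → (v ++ [ s ]) ≤W (v ++ L) → s ∈ L
    atoms-commuting a p = shortens⇒∈ comm (≤W⇒shortens {v} additive a p)
      where
      additive : Additive v L
      additive = trans (ℓ-ascents L v comm asc) (cong (ℓ v +_) (sym (ℓ-commuting comm)))

  -- Atoms of Boolean intervals

  Atom : Word → Word → Fin n → Set
  Atom v w s = IsAscent v s × (v ++ [ s ]) ≤W w

  atom? : ∀ v w s → Dec (Atom v w s)
  atom? v w s = (ℓ (v ++ [ s ]) ℕ.≟ suc (ℓ v)) ×-dec map′ ℓ⇒≤W ≤W⇒ℓ (ℓ w ℕ.≟ ℓ (v ++ [ s ]) + ℓ (inv (v ++ [ s ]) ++ w))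

  atoms : Word → Word → Subset n
  atoms v w = tabulate (λ s → does (atom? v w s))

  ∈atoms⇒atom : ∀ {v w s} → s ∈ˢ atoms v w → Atom v w s
  ∈atoms⇒atom {v} {w} {s} p = extract-proof (atom? v w s) (trans (sym (Vec.lookup∘tabulate _ s)) (Vec.[]=⇒lookup p))
    where
    extract-proof : ∀ {P : Set} (P? : Dec P) → does P? ≡ true → P
    extract-proof (yes p) _ = p

  atom⇒∈atoms : ∀ {v w s} → Atom v w s → s ∈ˢ atoms v w
  atom⇒∈atoms {v} {w} {s} a = Vec.lookup⇒[]= s _ (trans (Vec.lookup∘tabulate _ s) (dec-true (atom? v w s) a))

  atoms-⊆ : ∀ {v w w′} → w ~ w′ → atoms v w ⊆ atoms v w′
  atoms-⊆ p s∈ = let (a , q) = ∈atoms⇒atom s∈ in atom⇒∈atoms (a , ≤W-respʳ p q)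

  adjacent⇒3≤ : ∀ {s t k} → Adjacent s t → m M s t ≡ fin k → 3 ≤ k
  adjacent⇒3≤ {s} {t} adj e with m M s t
  adjacent⇒3≤ adj refl | fin k = adj

  ¬adjacent⇒commute : ∀ {s t} → s ≢ t → ¬ Adjacent s t → Commute s t
  ¬adjacent⇒commute {s} {t} s≢t ¬adj with m M s t in e
  ... | ∞     = contradiction _ ¬adj
  ... | fin k = s≢t , cong fin (ℕ.≤-antisym (ℕ.≤-pred (ℕ.≰⇒> ¬adj)) (off M s t s≢t k e))

  module _ {v w : Word} (v≤w : v ≤W w) (bool : BooleanInterval v w) where

    private
      k : ℕ
      k = proj₁ bool

      f : Subset k → Word
      f = proj₁ (proj₂ bool)

      bounds : ∀ A → v ≤W f A × f A ≤W w
      bounds = let (b , _) = proj₂ (proj₂ bool) in b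

      onto : ∀ x → v ≤W x → x ≤W w → Σ (Subset k) λ A → x ~ f A
      onto = let (_ , _ , o , _) = proj₂ (proj₂ bool) in o

      order : ∀ A B → (A ⊆ B) ⇔ (f A ≤W f B)
      order = let (_ , _ , _ , o) = proj₂ (proj₂ bool) in o

      f-reflects : ∀ A B → f A ≤W f B → A ⊆ B
      f-reflects A B = Equivalence.from (order A B)

      f-mono : ∀ A B → A ⊆ B → f A ≤W f B
      f-mono A B = Equivalence.to (order A B)

      below-all : ∀ A B → v ~ f A → A ⊆ B
      below-all A B p = f-reflects A B (≤W-respˡ p (proj₁ (bounds B)))

    -- If m(s,t) ≥ 3, then y = v s t lies between v s and the join of v s and v t. With A, B and D
    -- the subsets of v s, v t and y, either D misses B, so that D ⊆ A and y is too long, or D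
    -- contains A ∪ B and y is too short.
    atoms-¬adjacent : ∀ {s t} → s ≢ t → Atom v w s → Atom v w t → ¬ Adjacent s t
    atoms-¬adjacent {s} {t} s≢t (as , s≤w) (at , t≤w) adj
      with onto (v ++ [ s ]) (≤W-ascent as) s≤w | onto (v ++ [ t ]) (≤W-ascent at) t≤w
      where
      ≤W-ascent : ∀ {s} → IsAscent v s → v ≤W (v ++ [ s ])
      ≤W-ascent {s} a = factor⇒≤W [ s ] ~refl
        (ℕ.≤-trans (ℕ.+-monoʳ-≤ (ℓ v) (ℓ-length [ s ])) (ℕ.≤-reflexive (trans (ℕ.+-comm (ℓ v) 1) (sym a))))
    ... | A , pA | B , pB = shortens-both s≢t sh-s sh-t λ where
        (k , e , z , q , l) → long (adjacent⇒3≤ adj e) q l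
      where
      C = A ∪ B
      x = inv v ++ f C
      vx~ : v ++ x ~ f C
      vx~ = cancel-inv v (f C)
      add : Additive v x
      add = ≤W⇒additive (proj₁ (bounds C))
      sh-s : Shortens s x
      sh-s = ≤W⇒shortens {v} add as (≤W-respˡ (~sym pA) (≤W-respʳ (~sym vx~) (f-mono A C (Subset.p⊆p∪q B))))
      sh-t : Shortens t x
      sh-t = ≤W⇒shortens {v} add at (≤W-respˡ (~sym pB) (≤W-respʳ (~sym vx~) (f-mono B C (Subset.q⊆p∪q A B))))
      long : ∀ {k z} → 3 ≤ k → x ~ alt s t k ++ z → ℓ x ≡ k + ℓ z → ⊥
      long {k = suc (suc (suc j))} {z} (s≤s (s≤s (s≤s _))) q l = go
        where
        u = alt s t (suc j) ++ z
        y = v ++ s ∷ t ∷ []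
        le : 2 + ℓ u ≤ ℓ x
        le = ℕ.≤-trans (s≤s (s≤s (ℕ.≤-trans (ℓ-++ (alt s t (suc j)) z)
          (ℕ.+-monoˡ-≤ (ℓ z) (ℕ.≤-trans (ℓ-length (alt s t (suc j))) (ℕ.≤-reflexive (length-alt s t (suc j))))))))
          (ℕ.≤-reflexive (sym l))
        fac = additive-factor {v} (s ∷ t ∷ []) {u} add q le
        y-length : ℓ y ≡ ℓ v + 2
        y-length = proj₁ fac
        y≤fC : y ≤W f C
        y≤fC = ≤W-respʳ vx~ (proj₂ (proj₂ fac))
        s≤y : (v ++ [ s ]) ≤W y
        s≤y = factor⇒≤W [ t ] (≡⇒~ (sym (List.++-assoc v [ s ] [ t ])))
          (ℕ.≤-trans (ℕ.+-mono-≤ (ℕ.≤-reflexive as) (ℓ-length [ t ]))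
            (ℕ.≤-reflexive (trans (sym (ℕ.+-suc (ℓ v) 1)) (sym y-length))))
        short : ∀ {c} → ℓ y ≤ ℓ c → ℓ c ≤ ℓ v + 1 → ⊥
        short p q = ℕ.<-irrefl refl (ℕ.<-≤-trans (ℕ.+-monoʳ-< (ℓ v) (ℕ.n<1+n 1))
          (ℕ.≤-trans (ℕ.≤-reflexive (sym y-length)) (ℕ.≤-trans p q)))
        go : ⊥
        go with onto y (proj₁ (proj₂ fac)) (≤W-trans y≤fC (proj₂ (bounds C)))
        -- As v t covers v, the meet `D ∩ B` represents one of these two.
        ... | D , pD with ≤W-covered (proj₁ (bounds (D ∩ B))) (≤W-respʳ (~sym pB) (f-mono (D ∩ B) B (Subset.p∩q⊆q D B))) at
        ...   | inj₁ bottom = short {v ++ [ s ]} (≤W⇒≤ (≤W-respˡ (~sym pD) (≤W-respʳ (~sym pA) (f-mono D A D⊆A))))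
                                (ℕ.≤-reflexive (trans as (ℕ.+-comm 1 (ℓ v))))
          where
          D⊆C : D ⊆ C
          D⊆C = f-reflects D C (≤W-respˡ pD y≤fC)
          D⊆A : D ⊆ A
          D⊆A i∈D with Subset.x∈p∪q⁻ A B (D⊆C i∈D)
          ... | inj₁ i∈A = i∈A
          ... | inj₂ i∈B = below-all (D ∩ B) A bottom (Subset.x∈p∩q⁺ (i∈D , i∈B))
        -- Here C ⊆ D forces ℓ x ≤ 2, whereas x begins with an alternating word of length at least
        -- 3.
        ...   | inj₂ top = ℕ.<-irrefl refl (ℕ.≤-trans (ℕ.≤-trans (s≤s (s≤s (s≤s z≤n))) (ℕ.≤-reflexive (sym l)))
                             (ℕ.+-cancelˡ-≤ (ℓ v) _ _ (ℕ.≤-trans (ℕ.≤-reflexive (sym add))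
                               (ℕ.≤-trans (ℕ.≤-reflexive (ℓ-cong vx~))
                                 (ℕ.≤-trans (≤W⇒≤ (≤W-respʳ (~sym pD) (f-mono C D C⊆D))) (ℕ.≤-reflexive y-length))))))
          where
          A⊆D : A ⊆ D
          A⊆D = f-reflects A D (≤W-respˡ pA (≤W-respʳ pD s≤y))
          B⊆D : B ⊆ D
          B⊆D i∈B = Subset.p∩q⊆p D B (f-reflects B (D ∩ B) (≤W-refl (~sym (~trans top pB))) i∈B)
          C⊆D : C ⊆ D
          C⊆D i∈C with Subset.x∈p∪q⁻ A B i∈C
          ... | inj₁ i∈A = A⊆D i∈A
          ... | inj₂ i∈B = B⊆D i∈B

    atoms-independent : Independent v (atoms v w)
    atoms-independent = (λ s s∈ → ascent⇒¬Des {v} (proj₁ (∈atoms⇒atom s∈))) , pairwise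
      where
      pairwise : ∀ s t → s ∈ˢ atoms v w → t ∈ˢ atoms v w → ¬ Adjacent s t
      pairwise s t s∈ t∈ with s Fin.≟ t
      ... | yes refl = λ adj → contradiction (adjacent⇒3≤ adj (diag M s)) λ { (s≤s ()) }
      ... | no s≢t   = atoms-¬adjacent s≢t (∈atoms⇒atom s∈) (∈atoms⇒atom t∈)

    -- Let E and D be the subsets of w and v L. For i in E, some atom v s lies below the element of
    -- the singleton of i. The subset of v s contains i, and v s ≤ v L places i in D.
    top-is-join : ∀ {L} → Commuting L → (∀ {s} → s ∈ L ⇔ Atom v w s) → w ~ v ++ L
    top-is-join {L} comm L⇔ = result
      where
      x = inv v ++ w
      vx~ : v ++ x ~ w
      vx~ = cancel-inv v w
      add : Additive v x
      add = ≤W⇒additive v≤w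
      sh : ∀ {s} → s ∈ L → Shortens s x
      sh s∈L = let (a , p) = Equivalence.to L⇔ s∈L in ≤W⇒shortens {v} add a (≤W-respʳ (~sym vx~) p)
      fac = additive-factor {v} L {inv L ++ x} add (~sym (cancel-inv L x))
        (ℕ.≤-reflexive (sym (ℓ-shortening L x comm (All.tabulate sh))))
      vL≤w : (v ++ L) ≤W w
      vL≤w = ≤W-respʳ vx~ (proj₂ (proj₂ fac))
      addL : Additive v L
      addL = trans (proj₁ fac) (cong (ℓ v +_) (sym (ℓ-commuting comm)))
      result : w ~ v ++ L
      result with onto (v ++ L) (proj₁ (proj₂ fac)) vL≤w | onto w v≤w (≤W-refl ~refl)
      ... | D , pD | E , pE = ≤W-antisym (≤W-respˡ (~sym pE) (≤W-respʳ (~sym pD) (f-mono E D E⊆D))) vL≤w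
        where
        E⊆D : E ⊆ D
        E⊆D {i} i∈E = by-word (nf (inv v ++ f ⁅ i ⁆)) (nf~ _) (nf-reduced _)
          where
          i∈-if : ⁅ i ⁆ ⊆ D → i ∈ˢ D
          i∈-if sub = sub (Subset.x∈⁅x⁆ i)
          by-word : ∀ y → y ~ inv v ++ f ⁅ i ⁆ → Reduced y → i ∈ˢ D
          -- An empty word means that the singleton represents v, the least element, so it is
          -- contained in every subset.
          by-word []      p _   = i∈-if (below-all ⁅ i ⁆ D
            (~trans (≡⇒~ (sym (List.++-identityʳ v))) (~trans (++ˡ-cong v p) (cancel-inv v (f ⁅ i ⁆)))))
          -- The first letter of a reduced word is a left descent and so provides an atom.
          by-word (s ∷ y) p red with shortens⇒≤W {v} (≤W⇒additive (proj₁ (bounds ⁅ i ⁆))) sh′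
            where
            sh′ : Shortens s (inv v ++ f ⁅ i ⁆)
            sh′ = ℓ≤⇒shortens (ℕ.≤-trans (ℓ-minimal (~sym (~trans (∷-cong s (~sym p)) (ss-cancel s y))))
              (ℕ.≤-trans (ℕ.n≤1+n _) (red _ (~trans (nf~ _) (~sym p)))))
          ... | a , v≤vs , vs≤ with ≤W-respʳ (cancel-inv v (f ⁅ i ⁆)) vs≤
          ...   | vs≤fi with onto (v ++ [ s ]) v≤vs (≤W-trans vs≤fi (proj₂ (bounds ⁅ i ⁆)))
          ...     | G , pG with i Subset.∈? G
          ...       | yes i∈G = f-reflects G D (≤W-respˡ pG (≤W-respʳ pD vs≤vL)) i∈G
            where
            s∈L : s ∈ L
            s∈L = Equivalence.from L⇔ (a , ≤W-trans vs≤fi (proj₂ (bounds ⁅ i ⁆)))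
            vs≤vL : (v ++ [ s ]) ≤W (v ++ L)
            vs≤vL = proj₂ (proj₂ (shortens⇒≤W {v} addL (∈⇒shortens comm s∈L)))
          -- A subset of the singleton of i without i is empty, hence contained in the subset of v;
          -- then v s would be no longer than v.
          ...       | no i∉G = ⊥-elim (bad (onto v (≤W-refl ~refl) v≤w))
            where
            bad : ¬ (Σ (Subset k) λ Z → v ~ f Z)
            bad (Z , pZ) = ℕ.<-irrefl refl (ℕ.≤-trans (ℕ.≤-reflexive (sym a))
              (≤W⇒≤ (≤W-respˡ (~sym pG) (≤W-respʳ (~sym pZ) (f-mono G Z G⊆Z)))))
              where
              G⊆Z : G ⊆ Z
              G⊆Z {j} j∈G with Subset.x∈⁅y⁆⇒x≡y i (f-reflects G ⁅ i ⁆ (≤W-respˡ pG vs≤fi) j∈G)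
              ... | refl = contradiction j∈G i∉G

  -- The bijection with independent sets

  elements : Subset n → List (Fin n)
  elements I = filter (Subset._∈? I) (allFin n)

  ∈elements⇔ : ∀ {I s} → s ∈ elements I ⇔ s ∈ˢ I
  ∈elements⇔ {I} {s} = mk⇔ (λ p → proj₂ (∈-filter⁻ (Subset._∈? I) {xs = allFin n} p)) (∈-filter⁺ (Subset._∈? I) (∈-allFin s))

  elements-commuting : ∀ {v I} → Independent v I → Commuting (elements I)
  elements-commuting {v} {I} (_ , ¬adj) = pairs (Unique.filter⁺ (Subset._∈? I) (Unique.allFin⁺ n)) (Equivalence.to ∈elements⇔)
    where
    pairs : ∀ {L} → Unique L → (∀ {s} → s ∈ L → s ∈ˢ I) → Commuting L
    pairs []       _   = []
    pairs (u ∷ us) sub =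
      All.tabulate (λ t∈ → ¬adjacent⇒commute (All.lookup u t∈) (¬adj _ _ (sub (here refl)) (sub (there t∈))))
      ∷ pairs us (sub ∘ there)

  top≡join : ∀ {v w} (v≤w : v ≤W w) (b : BooleanInterval v w) → w ~ v ++ elements (atoms v w)
  top≡join v≤w b = top-is-join v≤w b (elements-commuting (atoms-independent v≤w b))
    (mk⇔ (∈atoms⇒atom ∘ Equivalence.to ∈elements⇔) (Equivalence.from ∈elements⇔ ∘ atom⇒∈atoms))

  -- Injectivity holds because w is the join of its atoms (`top≡join`), surjectivity because v ∏ I
  -- has exactly the atoms v s with s in I (`atoms-join`).
  boolean-bijection : ∀ v → Bijection (BoolUpSetoid v) (IndepSetoid v)
  boolean-bijection v = record
    { to        = λ (w , v≤w , b) → atoms v w , atoms-independent v≤w b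
    ; cong      = atoms-cong
    ; bijective =
        (λ {(w , v≤w , b)} {(w′ , v≤w′ , b′)} e →
          ~trans (top≡join v≤w b) (~trans (≡⇒~ (cong (λ I → v ++ elements I) e)) (~sym (top≡join v≤w′ b′)))) ,
        λ (I , ind) → (v ++ elements I , ≤W-commuting (elements-commuting ind) (ascents ind) ,
                        boolean-commuting (elements-commuting ind) (ascents ind)) ,
          λ z~ → trans (atoms-cong z~) (atoms-join ind)
    }
    where
    atoms-cong : ∀ {w w′} → w ~ w′ → atoms v w ≡ atoms v w′
    atoms-cong p = Subset.⊆-antisym (atoms-⊆ p) (atoms-⊆ (~sym p))
    ascents : ∀ {I} → Independent v I → All (IsAscent v) (elements I)
    ascents (¬des , _) = All.tabulate λ {s} s∈ → ¬Des⇒ascent {v} (¬des s (Equivalence.to ∈elements⇔ s∈))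
    atoms-join : ∀ {I} → Independent v I → atoms v (v ++ elements I) ≡ I
    atoms-join {I} ind = Subset.⊆-antisym
      (λ s∈ → let (a , p) = ∈atoms⇒atom s∈ in
        Equivalence.to ∈elements⇔ (atoms-commuting comm (ascents ind) a p))
      (λ {s} s∈I → let s∈L = Equivalence.from ∈elements⇔ s∈I
                       (a , _ , p) = shortens⇒≤W {v} add (∈⇒shortens comm s∈L)
                   in atom⇒∈atoms (a , p))
      where
      comm = elements-commuting ind
      add : Additive v (elements I)
      add = trans (ℓ-ascents (elements I) v comm (ascents ind)) (cong (ℓ v +_) (sym (ℓ-commuting comm)))

theorem1p2 : (n : ℕ) (M : CoxeterMatrix n) (v : Coxeter.Word M) →
    Bijection (Coxeter.BoolUpSetoid M v) (Coxeter.IndepSetoid M v)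
theorem1p2 n M v = BooleanIntervals.boolean-bijection M v
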